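{- Let $A(t,y,x)=\sum_{n\ge 0}t^n\sum_{\sigma\in\mathcal S_n(132)}y^{\mathrm{des}(\sigma)}x^{213\text{ -mch}(\sigma)}$. Then $$A(t,y,x)=\frac{ -\sqrt{t \left(2 y \left(x (t-1) t-t^2-1\right)+t y^2 (-xt+t+1)^2+t-2\right)+1}+(x-1) t^2 y (2 y-1)+t (y-1)+1}{2 t y ((x-1) ty+1)}.$$
   Context: $\mathcal S_n$ is the set of permutations of $\{1,\dots,n\}$ in one-line notation ($\mathcal S_0$ contains only the empty permutation, on which all statistics are $0$). For a word $w$ of distinct integers, $\mathrm{red}(w)$ replaces the $i$-th smallest letter by $i$. $\sigma\in\mathcal S_n$ avoids $\lambda\in\mathcal S_k$ (classical avoidance) if no (not necessarily contiguous) subsequence $\sigma_{i_1}\cdots\sigma_{i_k}$, $i_1<\dots<i_k$, has reduction $\lambda$; $\mathcal S_n(\lambda)$ is the set of such $\sigma$. $\gamma\text{ -mch}(\sigma)$ is the number of $i$ with $\mathrm{red}(\sigma_i\sigma_{i+1}\cdots\sigma_{i+k-1})=\gamma$ for $\gamma\in\mathcal S_k$. $\mathrm{des}(\sigma)=|\{i:\sigma_i>\sigma_{i+1}\}|$. The identity is one of formal power series in $t$ over $\mathbb Q[x,y]$ (quotients in the fraction field); the square root is the power series in $t$ with constant term $1$. -}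

module Defs where

open import Algebra.Bundles.Raw using (RawRing)
import Algebra.Definitions.RawSemiring as RawSemiringDefs
open import Data.List.Base
  using (List; []; _∷_; applyUpTo; cartesianProductWith; drop; filter; foldr;
         length; map; take; upTo; zip)
open import Data.List.Properties using (≡-dec)
open import Data.List.Relation.Binary.Sublist.Propositional
  using (_⊆_; []; _∷_; _∷ʳ_)
open import Data.List.Relation.Unary.Unique.DecPropositional using (unique?)
open import Data.Nat.Base as ℕ using (ℕ; zero; suc)
import Data.Nat.Properties as ℕ
open import Data.Fin.Base using (toℕ)
open import Data.Product.Base using (_×_; _,_; ∃-syntax)
open import Data.Rational.Base as ℚ using (ℚ)
open import Data.Sum.Base using (_⊎_; inj₁; inj₂)
open import Level using (Level; _⊔_)
open import Relation.Binary.PropositionalEquality using (_≡_; refl)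
open import Relation.Nullary using (¬_; Dec; ¬?)
open import Relation.Nullary.Decidable using (map′; _⊎-dec_)
open import Relation.Unary using (Pred; Decidable)

private
  variable
    c ℓ p : Level

-- Permutations in one-line notation and their statistics

Word : Set
Word = List ℕ

words : (letters : List ℕ) → ℕ → List Word
words letters zero    = [] ∷ []
words letters (suc k) = cartesianProductWith _∷_ letters (words letters k)

𝒮 : ℕ → List Word
𝒮 n = filter (unique? ℕ._≟_) (words (applyUpTo suc n) n)

-- In a word of distinct letters, a is the i-th smallest letter exactly
-- when i letters are ≤ a.
red : Word → Word
red w = map (λ a → length (filter (ℕ._≤? a) w)) w

_Contains_ : Word → Word → Set
σ Contains pat = ∃[ u ] (u ⊆ σ × red u ≡ pat)

_Avoids_ : Word → Word → Set
σ Avoids pat = ¬ (σ Contains pat)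

anySublist? : {A : Set} {P : Pred (List A) p} → Decidable P →
              ∀ w → Dec (∃[ u ] (u ⊆ w × P u))
anySublist? P? [] = map′ (λ pr → [] , [] , pr) (λ { (_ , [] , pr) → pr }) (P? [])
anySublist? {P = P} P? (a ∷ w) =
  map′ to from (anySublist? P? w ⊎-dec anySublist? (λ u → P? (a ∷ u)) w)
  where
  to : (∃[ u ] (u ⊆ w × P u)) ⊎ (∃[ u ] (u ⊆ w × P (a ∷ u))) →
       ∃[ u ] (u ⊆ a ∷ w × P u)
  to (inj₁ (u , s , pr)) = u , a ∷ʳ s , pr
  to (inj₂ (u , s , pr)) = a ∷ u , refl ∷ s , pr

  from : ∃[ u ] (u ⊆ a ∷ w × P u) →
         (∃[ u ] (u ⊆ w × P u)) ⊎ (∃[ u ] (u ⊆ w × P (a ∷ u)))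
  from (u , _ ∷ʳ s , pr)          = inj₁ (u , s , pr)
  from (_ ∷ u , refl ∷ s , pr) = inj₂ (u , s , pr)

avoids? : ∀ pat → Decidable (_Avoids pat)
avoids? pat σ = ¬? (anySublist? (λ u → ≡-dec ℕ._≟_ (red u) pat) σ)

𝒮[_] : Word → ℕ → List Word
𝒮[ pat ] n = filter (avoids? pat) (𝒮 n)

-- Windows running past the end of the word are shorter than the pattern,
-- so they never match.
mch : Word → Word → ℕ
mch pat σ =
  length (filter (λ i → ≡-dec ℕ._≟_ (red (take (length pat) (drop i σ))) pat)
                 (upTo (length σ)))

des : Word → ℕ
des σ = length (filter (λ (a , b) → b ℕ.<? a) (zip σ (drop 1 σ)))

-- Polynomials: coefficient lists, constant term first, compared
-- coefficientwise so that trailing zeros are irrelevant.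

module Polynomial (R : RawRing c ℓ) where
  open RawRing R

  coeff : List Carrier → ℕ → Carrier
  coeff []      _       = 0#
  coeff (a ∷ f) zero    = a
  coeff (a ∷ f) (suc n) = coeff f n

  add : List Carrier → List Carrier → List Carrier
  add []      g       = g
  add (a ∷ f) []      = a ∷ f
  add (a ∷ f) (b ∷ g) = (a + b) ∷ add f g

  mul : List Carrier → List Carrier → List Carrier
  mul []      g = []
  mul (a ∷ f) g = add (map (a *_) g) (0# ∷ mul f g)

  rawRing : RawRing c ℓ
  rawRing = record
    { Carrier = List Carrier
    ; _≈_     = λ f g → ∀ n → coeff f n ≈ coeff g n
    ; _+_     = add
    ; _*_     = mul
    ; -_      = map (-_)
    ; 0#      = []
    ; 1#      = 1# ∷ []
    }

  const : Carrier → List Carrier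
  const a = a ∷ []

  X : List Carrier
  X = 0# ∷ 1# ∷ []

module PowerSeries (R : RawRing c ℓ) where
  open RawRing R
  open RawSemiringDefs rawSemiring using (sum)

  const : Carrier → (ℕ → Carrier)
  const a zero    = a
  const a (suc _) = 0#

  X : ℕ → Carrier
  X 1 = 1#
  X _ = 0#

  rawRing : RawRing c ℓ
  rawRing = record
    { Carrier = ℕ → Carrier
    ; _≈_     = λ f g → ∀ n → f n ≈ g n
    ; _+_     = λ f g n → f n + g n
    ; _*_     = λ f g n → sum {suc n} (λ i → f (toℕ i) * g (n ℕ.∸ toℕ i))
    ; -_      = λ f n → - f n
    ; 0#      = λ _ → 0#
    ; 1#      = const 1#
    }

  -- If R is an integral domain in which 2 ≉ 0, at most one s satisfies this.
  _IsSqrtOf_ : (s f : ℕ → Carrier) → Set ℓ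
  s IsSqrtOf f = (∀ n → RawRing._*_ rawRing s s n ≈ f n) × s 0 ≈ 1#

module FractionField (R : RawRing c ℓ) where
  open RawRing R

  record Fraction : Set (c ⊔ ℓ) where
    constructor _/_[_]
    field
      num   : Carrier
      den   : Carrier
      den≉0 : den ≉ 0#

  infix 4 _≃_
  _≃_ : Fraction → Fraction → Set ℓ
  p ≃ q = num p * den q ≈ num q * den p
    where open Fraction

module ℚ[x] = Polynomial ℚ.+-*-rawRing
module ℚ[x][y] = Polynomial ℚ[x].rawRing

ℚ[x,y] : RawRing _ _
ℚ[x,y] = ℚ[x][y].rawRing

module ℚ[x,y]⟦t⟧ = PowerSeries ℚ[x,y]

A : ℕ → RawRing.Carrier ℚ[x,y]
A n = foldr _+_ 0# (map weight (𝒮[ 1 ∷ 3 ∷ 2 ∷ [] ] n))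
  where
  open RawRing ℚ[x,y]
  open RawSemiringDefs rawSemiring using (_^_)

  weight : Word → Carrier
  weight σ = ℚ[x][y].X ^ des σ * ℚ[x][y].const ℚ[x].X ^ mch (2 ∷ 1 ∷ 3 ∷ []) σ

open ℚ[x,y]⟦t⟧ public using (_IsSqrtOf_)
open RawRing ℚ[x,y]⟦t⟧.rawRing public
open RawSemiringDefs rawSemiring public using (_^_)
open FractionField ℚ[x,y]⟦t⟧.rawRing public

infixl 6 _-_
_-_ : Carrier → Carrier → Carrier
f - g = f + - g

2# t x y : Carrier
2# = 1# + 1#
t  = ℚ[x,y]⟦t⟧.X
x  = ℚ[x,y]⟦t⟧.const (ℚ[x][y].const ℚ[x].X)
y  = ℚ[x,y]⟦t⟧.const ℚ[x][y].X

1≉0 : 1# ≉ 0#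
1≉0 eq with () ← eq 0 0 0

denominator≉0 : 2# * t * y * ((x - 1#) * t * y + 1#) ≉ 0#
denominator≉0 eq with () ← eq 1 1 0

↑_ : Carrier → Fraction
↑ f = f / 1# [ 1≉0 ]

{-# OPTIONS --safe #-}
-- A nonempty 132-avoider is L m R with m the maximum, every letter of L above
-- every letter of R, and L, R avoiding 132; so 132-avoiders are binary trees.
-- A descent is created exactly at m when R is nonempty, and a 213 is created
-- exactly at m when L ends with a descent.  With G = 1 + y (A - 1) and E the
-- series of the avoiders ending with a descent, this gives
--   A = 1 + t (A + (x - 1) E) G.
-- Ending with a descent means ending with the smallest letter (and having two
-- letters), and the series D of the avoiders ending with the smallest letter
-- satisfies the same fixed point equation as t G, whence E = t (G - 1).  The
-- resulting equation for A is quadratic, and completing the square gives √Δ.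

module Submission where

open import Algebra.Bundles using (CommutativeRing; RawRing)
import Algebra.Construct.Pointwise as Pointwise
import Algebra.Definitions.RawSemiring as RawSemiringDefs
import Algebra.Morphism.RingMonomorphism as RingMonomorphism
import Algebra.Properties.CommutativeSemigroup as CommutativeSemigroupProperties
import Algebra.Properties.Ring as RingProperties
import Algebra.Properties.Semiring.Exp as SemiringExp
import Algebra.Properties.Semiring.Mult.TCOptimised as Mult
import Algebra.Properties.Semiring.Sum as SemiringSum
import Algebra.Solver.Ring as RingSolver
open import Algebra.Solver.Ring.AlmostCommutativeRing using (_-Raw-AlmostCommutative⟶_; fromCommutativeRing)
open import Data.Bool.Base using (Bool; not; true; false; if_then_else_)
open import Data.Fin.Base using (Fin; zero; suc; toℕ; fromℕ<)
open import Data.Fin.Properties using (toℕ-fromℕ<; toℕ-injective; toℕ≤pred[n])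
open import Data.Integer.Base as ℤ using (ℤ)
import Data.Integer.Properties as ℤ
open import Data.List.Base using (List; []; _∷_; _++_; applyUpTo; cartesianProductWith; concat; drop; filter; foldr; length; map; tabulate; take)
open import Data.List.Membership.Propositional using (_∈_)
open import Data.List.Membership.Propositional.Properties using (∈-concat⁺′; ∈-concat⁻′; ∈-tabulate⁺; ∈-tabulate⁻; ∈-cartesianProductWith⁺; ∈-cartesianProductWith⁻; ∈-filter⁺; ∈-filter⁻; ∈-applyUpTo⁺; ∈-applyUpTo⁻; ∈-∃++; ∈-map⁺; ∈-map⁻; ∈-++⁺ʳ)
open import Data.List.Membership.Propositional.Properties.WithK using (unique∧set⇒bag)
open import Data.List.Properties using (≡-dec; filter-accept; filter-reject; length-++; tabulate-cong)
open import Data.List.Relation.Binary.BagAndSetEquality using (∼bag⇒↭)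
open import Data.List.Relation.Binary.Permutation.Propositional as ↭ using (_↭_)
open import Data.List.Relation.Binary.Sublist.Propositional using (_⊆_; []; _∷_; _∷ʳ_; from∈; to∈; ⊆-refl; ⊆-trans)
open import Data.List.Relation.Binary.Sublist.Propositional.Properties using (++⁺; ++⁺ˡ; ++⁺ʳ; All-resp-⊆)
open import Data.List.Relation.Unary.All as All using (All; []; _∷_)
import Data.List.Relation.Unary.All.Properties as All
open import Data.List.Relation.Unary.AllPairs using ([]; _∷_)
import Data.List.Relation.Unary.AllPairs.Properties as AllPairs
open import Data.List.Relation.Unary.Any using (here; there)
open import Data.List.Relation.Unary.Unique.DecPropositional using (unique?)
open import Data.List.Relation.Unary.Unique.Propositional using (Unique)
import Data.List.Relation.Unary.Unique.Propositional.Properties as Unique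
open import Data.Maybe.Base using (Maybe; nothing; just)
open import Data.Nat.Base as ℕ using (ℕ; zero; suc; _∸_; _≤_; z≤n; s≤s)
import Data.Nat.Properties as ℕ
open import Data.Product.Base using (_,_; proj₁; proj₂)
import Data.Rational.Properties as ℚ
open import Function.Base using (_∘_; id)
open import Function.Bundles using (mk⇔)
open import Level using (Level)
open import Relation.Binary.PropositionalEquality as ≡ using (_≡_)
import Relation.Binary.Reasoning.Setoid as SetoidReasoning
open import Relation.Nullary using (¬_; yes; no; contradiction)
open import Relation.Nullary.Decidable using (does; dec-true; dec-false)
open import Relation.Unary using (Pred; Decidable)
open import Defs using (Word; words; red; _Avoids_; avoids?; mch; des; 𝒮; 𝒮[_]; module PowerSeries; module Polynomial; module FractionField)

-- A 132-avoider whose last two letters are `a b` with `b < a` ends with its smallest letter,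
-- because an earlier `c < b` would make `c a b` a 132. The two conditions differ only on the
-- one-letter word, so `D = E + t`. The word `L m R` ends with a descent exactly when `R` is
-- nonempty and ends with its smallest letter; with `P = A + (x - 1) E` the factor due to `L`, and
-- `y` for the descent at `m`, this reads `E = t P (y D)`. Hence `D = t + t P y D`, while
-- multiplying `G = 1 + y (A - 1)` by `t` and inserting `A - 1 = t P G` gives the same equation for
-- `t G`. No square root is ever extracted: the claimed quotient, solved for its root, is an
-- explicit expression in `A`. The quadratic equation shows that it squares to the discriminant, and
-- its constant term selects the branch. Equality of fractions is cross-multiplied, so nothing is
-- divided either. All of this works over an arbitrary commutative ring with two chosen elements `x`
-- and `y`.

private
  variable
    c ℓ : Level

-- The commutative ring of formal power series.

module PowerSeriesRing (R : CommutativeRing c ℓ) where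
  open CommutativeRing R
  open SemiringSum semiring
  open CommutativeSemigroupProperties +-commutativeSemigroup using (x∙yz≈y∙xz)
  open SetoidReasoning setoid
  open PowerSeries rawRing public

  infixl 7 _⊛_
  _⊛_ : (f g : ℕ → Carrier) → ℕ → Carrier
  _⊛_ = RawRing._*_ (PowerSeries.rawRing (CommutativeRing.rawRing R))

  tail : (ℕ → Carrier) → ℕ → Carrier
  tail f = f ∘ suc

  ⊛-cong : ∀ {f f′ g g′} → (∀ n → f n ≈ f′ n) → (∀ n → g n ≈ g′ n) →
           ∀ n → (f ⊛ g) n ≈ (f′ ⊛ g′) n
  ⊛-cong f≈f′ g≈g′ n = sum-cong-≋ {n = suc n} λ i → *-cong (f≈f′ (toℕ i)) (g≈g′ (n ℕ.∸ toℕ i))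

  ⊛-scaleˡ : ∀ a f g n → ((λ i → a * f i) ⊛ g) n ≈ a * (f ⊛ g) n
  ⊛-scaleˡ a f g n = begin
    ((λ i → a * f i) ⊛ g) n                       ≈⟨ sum-cong-≋ {n = suc n} (λ i → *-assoc a (f (toℕ i)) (g (n ℕ.∸ toℕ i))) ⟩
    sum {suc n} (λ i → a * (f (toℕ i) * g (n ℕ.∸ toℕ i)))  ≈⟨ *-distribˡ-sum {suc n} a (λ i → f (toℕ i) * g (n ℕ.∸ toℕ i)) ⟨
    a * (f ⊛ g) n                                 ∎

  ⊛-distribʳ : ∀ h f g n → ((λ i → f i + g i) ⊛ h) n ≈ (f ⊛ h) n + (g ⊛ h) n
  ⊛-distribʳ h f g n = begin
    ((λ i → f i + g i) ⊛ h) n   ≈⟨ sum-cong-≋ {n = suc n} (λ i → distribʳ (h (n ℕ.∸ toℕ i)) (f (toℕ i)) (g (toℕ i))) ⟩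
    sum {suc n} (λ i → f (toℕ i) * h (n ℕ.∸ toℕ i) + g (toℕ i) * h (n ℕ.∸ toℕ i))
                                ≈⟨ ∑-distrib-+ {suc n} (λ i → f (toℕ i) * h (n ℕ.∸ toℕ i)) (λ i → g (toℕ i) * h (n ℕ.∸ toℕ i)) ⟩
    (f ⊛ h) n + (g ⊛ h) n       ∎

  ⊛-zeroˡ : ∀ g n → ((λ _ → 0#) ⊛ g) n ≈ 0#
  ⊛-zeroˡ g n = begin
    ((λ _ → 0#) ⊛ g) n           ≈⟨ sum-cong-≋ {n = suc n} (λ i → zeroˡ (g (n ℕ.∸ toℕ i))) ⟩
    sum {suc n} (λ _ → 0#)       ≈⟨ sum-replicate-zero (suc n) ⟩
    0#                           ∎

  -- The convolution unfolds by peeling off the constant term of the left factor. Peeling it off the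
  -- right factor as well is what makes the induction in `⊛-comm` close.
  ⊛-sucʳ : ∀ f g n → (f ⊛ g) (suc n) ≈ f (suc n) * g 0 + (f ⊛ tail g) n
  ⊛-sucʳ f g zero    = x∙yz≈y∙xz _ _ _
  ⊛-sucʳ f g (suc n) = trans (+-congˡ (⊛-sucʳ (tail f) g n)) (x∙yz≈y∙xz _ _ _)

  ⊛-comm : ∀ f g n → (f ⊛ g) n ≈ (g ⊛ f) n
  ⊛-comm f g zero    = +-congʳ (*-comm (f 0) (g 0))
  ⊛-comm f g (suc n) = begin
    f 0 * g (suc n) + (tail f ⊛ g) n  ≈⟨ +-cong (*-comm (f 0) (g (suc n))) (⊛-comm (tail f) g n) ⟩
    g (suc n) * f 0 + (g ⊛ tail f) n  ≈⟨ ⊛-sucʳ g f n ⟨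
    (g ⊛ f) (suc n)                   ∎

  ⊛-assoc : ∀ f g h n → ((f ⊛ g) ⊛ h) n ≈ (f ⊛ (g ⊛ h)) n
  ⊛-assoc f g h zero    = +-congʳ (begin
    (f 0 * g 0 + 0#) * h 0    ≈⟨ *-congʳ (+-identityʳ _) ⟩
    f 0 * g 0 * h 0           ≈⟨ *-assoc _ _ _ ⟩
    f 0 * (g 0 * h 0)         ≈⟨ *-congˡ (+-identityʳ _) ⟨
    f 0 * (g 0 * h 0 + 0#)    ∎)
  ⊛-assoc f g h (suc n) = begin
    -- By computation, `tail (f ⊛ g)` is `f 0` times `tail g` plus `tail f ⊛ g`.
    (f 0 * g 0 + 0#) * h (suc n) + (tail (f ⊛ g) ⊛ h) n
      ≈⟨ +-cong (trans (*-congʳ (+-identityʳ _)) (*-assoc _ _ _)) (⊛-distribʳ h (λ i → f 0 * tail g i) (tail f ⊛ g) n) ⟩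
    f 0 * (g 0 * h (suc n)) + (((λ i → f 0 * tail g i) ⊛ h) n + ((tail f ⊛ g) ⊛ h) n)
      ≈⟨ +-congˡ (+-cong (⊛-scaleˡ (f 0) (tail g) h n) (⊛-assoc (tail f) g h n)) ⟩
    f 0 * (g 0 * h (suc n)) + (f 0 * (tail g ⊛ h) n + (tail f ⊛ (g ⊛ h)) n)
      ≈⟨ +-assoc _ _ _ ⟨
    f 0 * (g 0 * h (suc n)) + f 0 * (tail g ⊛ h) n + (tail f ⊛ (g ⊛ h)) n
      ≈⟨ +-congʳ (distribˡ (f 0) _ _) ⟨
    f 0 * (g ⊛ h) (suc n) + (tail f ⊛ (g ⊛ h)) n
      ∎

  const-⊛ : ∀ a f n → (const a ⊛ f) n ≈ a * f n
  const-⊛ a f zero    = +-identityʳ _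
  const-⊛ a f (suc n) = trans (+-congˡ (⊛-zeroˡ f n)) (+-identityʳ _)

  ⊛-identityˡ : ∀ f n → (const 1# ⊛ f) n ≈ f n
  ⊛-identityˡ f n = trans (const-⊛ 1# f n) (*-identityˡ (f n))

  X-⊛-suc : ∀ f n → (X ⊛ f) (suc n) ≈ f n
  X-⊛-suc f n = begin
    0# * f (suc n) + (tail X ⊛ f) n   ≈⟨ +-cong (zeroˡ _) (⊛-cong {g = f} tail-X (λ _ → refl) n) ⟩
    0# + (const 1# ⊛ f) n             ≈⟨ +-identityˡ _ ⟩
    (const 1# ⊛ f) n                  ≈⟨ ⊛-identityˡ f n ⟩
    f n                               ∎
    where
    tail-X : ∀ n → tail X n ≈ const 1# n
    tail-X zero    = refl
    tail-X (suc _) = refl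

  commutativeRing : CommutativeRing c ℓ
  commutativeRing = record
    { RawRing (PowerSeries.rawRing (CommutativeRing.rawRing R))
    ; isCommutativeRing = record
      { isRing = record
        { +-isAbelianGroup = Pointwise.isAbelianGroup ℕ +-isAbelianGroup
        ; *-cong           = λ {f} {f′} {g} {g′} p q → ⊛-cong {f} {f′} {g} {g′} p q
        ; *-assoc          = ⊛-assoc
        ; *-identity       = ⊛-identityˡ , λ f n → trans (⊛-comm f (const 1#) n) (⊛-identityˡ f n)
        ; distrib          = (λ f g h n → trans (⊛-comm f (λ i → g i + h i) n)
                                (trans (⊛-distribʳ f g h n)
                                  (+-cong (⊛-comm g f n) (⊛-comm h f n))))
                           , ⊛-distribʳ
        }
      ; *-comm = ⊛-comm
      }
    }

-- Polynomials as a subring of the power series.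

module PolynomialRing (R : CommutativeRing c ℓ) where
  open CommutativeRing R
  open RingProperties ring using (-0#≈0#)
  open PowerSeriesRing R using (_⊛_; ⊛-zeroˡ)
  private
    module S = CommutativeRing (PowerSeriesRing.commutativeRing R)
  open Polynomial rawRing

  coeff-add : ∀ f g n → coeff (add f g) n ≈ coeff f n + coeff g n
  coeff-add []      g       n       = sym (+-identityˡ _)
  coeff-add (a ∷ f) []      n       = sym (+-identityʳ _)
  coeff-add (a ∷ f) (b ∷ g) zero    = refl
  coeff-add (a ∷ f) (b ∷ g) (suc n) = coeff-add f g n

  coeff-neg : ∀ f n → coeff (map (-_) f) n ≈ - coeff f n
  coeff-neg []      n       = sym -0#≈0#
  coeff-neg (a ∷ f) zero    = refl
  coeff-neg (a ∷ f) (suc n) = coeff-neg f n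

  coeff-scale : ∀ a f n → coeff (map (a *_) f) n ≈ a * coeff f n
  coeff-scale a []      n       = sym (zeroʳ a)
  coeff-scale a (b ∷ f) zero    = refl
  coeff-scale a (b ∷ f) (suc n) = coeff-scale a f n

  coeff-mul : ∀ f g n → coeff (mul f g) n ≈ (coeff f ⊛ coeff g) n
  coeff-mul []      g n       = sym (⊛-zeroˡ (coeff g) n)
  coeff-mul (a ∷ f) g zero    = trans (coeff-add (map (a *_) g) _ 0) (+-congʳ (coeff-scale a g 0))
  coeff-mul (a ∷ f) g (suc n) = trans (coeff-add (map (a *_) g) _ (suc n))
                                  (+-cong (coeff-scale a g (suc n)) (coeff-mul f g n))

  coeff-1 : ∀ n → coeff (1# ∷ []) n ≈ S.1# n
  coeff-1 zero    = refl
  coeff-1 (suc _) = refl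

  -- Equality of polynomials is by definition equality of the series `coeff`, so `coeff` is
  -- injective for free and the ring laws are pulled back from power series.
  commutativeRing : CommutativeRing c ℓ
  commutativeRing = record
    { RawRing (Polynomial.rawRing (CommutativeRing.rawRing R))
    ; isCommutativeRing = RingMonomorphism.isCommutativeRing {⟦_⟧ = coeff}
        (record
          { isRingHomomorphism = record
            { isSemiringHomomorphism = record
              { isNearSemiringHomomorphism = record
                { +-isMonoidHomomorphism = record
                  { isMagmaHomomorphism = record
                    { isRelHomomorphism = record { cong = id }
                    ; homo = coeff-add
                    }
                  ; ε-homo = λ _ → refl
                  }
                ; *-homo = coeff-mul
                }
              ; 1#-homo = coeff-1
              }
            ; -‿homo = coeff-neg
            }
          ; injective = id
          })
        S.isCommutativeRing
    }

-- A ring solver with integer coefficients.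

module IntegerCoefficientSolver (R : CommutativeRing c ℓ) where
  open import Data.Integer.Base using (+_; -[1+_])
  open CommutativeRing R
  open RingProperties ring
  open CommutativeSemigroupProperties +-commutativeSemigroup using (interchange; x∙yz≈y∙xz)
  open Mult semiring
  open SetoidReasoning setoid

  private
    -- The optimised multiple makes `fromℤ (+ 1)` reduce to `1#`, so that `con (+ 1)` denotes `1#`
    -- itself in solved equations.
    fromℤ : ℤ → Carrier
    fromℤ (+ n)    = n × 1#
    fromℤ -[1+ n ] = - (suc n × 1#)

    fromℤ-neg : ∀ i → fromℤ (ℤ.- i) ≈ - fromℤ i
    fromℤ-neg (+ zero)    = sym -0#≈0#
    fromℤ-neg (+ (suc n)) = refl
    fromℤ-neg -[1+ n ]    = sym (-‿involutive _)

    fromℤ-⊖ : ∀ m n → fromℤ (m ℤ.⊖ n) ≈ m × 1# - n × 1#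
    fromℤ-⊖ m       zero    = trans (sym (+-identityʳ _)) (+-congˡ (sym -0#≈0#))
    fromℤ-⊖ zero    (suc n) = sym (+-identityˡ _)
    fromℤ-⊖ (suc m) (suc n) = begin
      fromℤ (suc m ℤ.⊖ suc n)                   ≡⟨ ≡.cong fromℤ (ℤ.[1+m]⊖[1+n]≡m⊖n m n) ⟩
      fromℤ (m ℤ.⊖ n)                           ≈⟨ fromℤ-⊖ m n ⟩
      m × 1# - n × 1#                           ≈⟨ +-identityˡ _ ⟨
      0# + (m × 1# - n × 1#)                    ≈⟨ +-congʳ (-‿inverseʳ 1#) ⟨
      (1# - 1#) + (m × 1# - n × 1#)             ≈⟨ interchange _ _ _ _ ⟩
      (1# + m × 1#) + (- 1# - n × 1#)           ≈⟨ +-congˡ (-‿+-comm _ _) ⟩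
      (1# + m × 1#) - (1# + n × 1#)             ≈⟨ +-cong (1+× m 1#) (-‿cong (1+× n 1#)) ⟨
      suc m × 1# - suc n × 1#                   ∎

    fromℤ-+ : ∀ i j → fromℤ (i ℤ.+ j) ≈ fromℤ i + fromℤ j
    fromℤ-+ (+ m)    (+ n)    = ×-homo-+ 1# m n
    fromℤ-+ (+ m)    -[1+ n ] = fromℤ-⊖ m (suc n)
    fromℤ-+ -[1+ m ] (+ n)    = trans (fromℤ-⊖ n (suc m)) (+-comm _ _)
    fromℤ-+ -[1+ m ] -[1+ n ] = begin
      - (suc (suc (m ℕ.+ n)) × 1#)          ≈⟨ -‿cong (1+× (suc (m ℕ.+ n)) 1#) ⟩
      - (1# + suc (m ℕ.+ n) × 1#)           ≈⟨ -‿cong (+-congˡ (×-homo-+ 1# (suc m) n)) ⟩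
      - (1# + (suc m × 1# + n × 1#))        ≈⟨ -‿cong (x∙yz≈y∙xz _ _ _) ⟩
      - (suc m × 1# + (1# + n × 1#))        ≈⟨ -‿cong (+-congˡ (1+× n 1#)) ⟨
      - (suc m × 1# + suc n × 1#)           ≈⟨ -‿+-comm _ _ ⟨
      - (suc m × 1#) - suc n × 1#           ∎

    fromℤ-*ʳ : ∀ i n → fromℤ (i ℤ.* + n) ≈ fromℤ i * (n × 1#)
    fromℤ-*ʳ (+ m) n = begin
      fromℤ (+ m ℤ.* + n)       ≡⟨ ≡.cong fromℤ (ℤ.pos-* m n) ⟨
      (m ℕ.* n) × 1#            ≈⟨ ×1-homo-* m n ⟩
      (m × 1#) * (n × 1#)       ∎
    fromℤ-*ʳ -[1+ m ] n = begin
      fromℤ (-[1+ m ] ℤ.* + n)          ≡⟨ ≡.cong fromℤ (ℤ.neg-distribˡ-* (+ suc m) (+ n)) ⟨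
      fromℤ (ℤ.- (+ suc m ℤ.* + n))     ≈⟨ fromℤ-neg (+ suc m ℤ.* + n) ⟩
      - fromℤ (+ suc m ℤ.* + n)         ≈⟨ -‿cong (fromℤ-*ʳ (+ suc m) n) ⟩
      - ((suc m × 1#) * (n × 1#))       ≈⟨ -‿distribˡ-* _ _ ⟩
      - (suc m × 1#) * (n × 1#)         ∎

    fromℤ-* : ∀ i j → fromℤ (i ℤ.* j) ≈ fromℤ i * fromℤ j
    fromℤ-* i (+ n)    = fromℤ-*ʳ i n
    fromℤ-* i -[1+ n ] = begin
      fromℤ (i ℤ.* -[1+ n ])            ≡⟨ ≡.cong fromℤ (ℤ.neg-distribʳ-* i (+ suc n)) ⟨
      fromℤ (ℤ.- (i ℤ.* + suc n))       ≈⟨ fromℤ-neg (i ℤ.* + suc n) ⟩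
      - fromℤ (i ℤ.* + suc n)           ≈⟨ -‿cong (fromℤ-*ʳ i (suc n)) ⟩
      - (fromℤ i * (suc n × 1#))        ≈⟨ -‿distribʳ-* _ _ ⟩
      fromℤ i * - (suc n × 1#)          ∎

    morphism : ℤ.+-*-rawRing -Raw-AlmostCommutative⟶ fromCommutativeRing R
    morphism = record
      { ⟦_⟧    = fromℤ
      ; +-homo = fromℤ-+
      ; *-homo = fromℤ-*
      ; -‿homo = fromℤ-neg
      ; 0-homo = refl
      ; 1-homo = refl
      }

    -- Equality in an abstract ring cannot be decided; integer coefficients can be compared, which
    -- lets opposite terms cancel.
    _coeff≟_ : ∀ i j → Maybe (fromℤ i ≈ fromℤ j)
    i coeff≟ j with i ℤ.≟ j
    ... | yes i≡j = just (reflexive (≡.cong fromℤ i≡j))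
    ... | no  _   = nothing

  open RingSolver ℤ.+-*-rawRing (fromCommutativeRing R) morphism _coeff≟_ public

-- The quadratic equation and its explicit root.

-- The operations are parameters so that two presentations of the same concrete
-- ring are compared operation by operation, not by evaluating the expressions.
Discriminant :
  {C : Set c} (Q : C → C → Set ℓ) (_+_ _*_ _-_ : C → C → C) (-_ : C → C) (_^_ : C → ℕ → C)
  (1# 2# t y x s : C) → Set ℓ
Discriminant Q _+_ _*_ _-_ -_ _^_ 1# 2# t y x s =
  Q s ((t * (((((2# * y) * ((((x * (t - 1#)) * t) - (t ^ 2)) - 1#))
                + ((t * (y ^ 2)) * ((((- (x * t)) + t) + 1#) ^ 2)))
               + t) - 2#))
       + 1#)

Quotient :
  {C : Set c} (Q : C → C → C → Set ℓ) (_+_ _*_ _-_ : C → C → C) (-_ : C → C) (_^_ : C → ℕ → C)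
  (1# 2# t y x s F : C) → Set ℓ
Quotient Q _+_ _*_ _-_ -_ _^_ 1# 2# t y x s F =
  Q F (((((- s) + ((((x - 1#) * (t ^ 2)) * y) * ((2# * y) - 1#))) + (t * (y - 1#))) + 1#))
      (((2# * t) * y) * ((((x - 1#) * t) * y) + 1#))

module SquareRoot (R : CommutativeRing c ℓ) (t y x A : CommutativeRing.Carrier R) where
  open CommutativeRing R
  open import Data.Integer.Base using (+_)
  open RawSemiringDefs (RawRing.rawSemiring rawRing) using (_^_)
  open IntegerCoefficientSolver R
  open SetoidReasoning setoid

  2# : Carrier
  2# = 1# + 1#

  private
    discriminant half : Carrier
    discriminant = t * (2# * y * (x * (t - 1#) * t - t ^ 2 - 1#)
                        + t * y ^ 2 * (- (x * t) + t + 1#) ^ 2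
                        + t - 2#)
                   + 1#
    half = 2# * t * y * ((x - 1#) * t * y + 1#)

  -- `Φ` is `1 + t (A + (x - 1) E) G` with `E = t y (A - 1)` and `G = 1 + y (A - 1)` substituted.
  Φ root : Carrier
  Φ    = 1# + t * ((A + (x - 1#) * (t * (y * (A - 1#)))) * (1# + y * (A - 1#)))
  root = (x - 1#) * t ^ 2 * y * (2# * y - 1#) + t * (y - 1#) + 1# - A * half

  private
    module Syntax {n} (t y x A : Polynomial n) where
      :1 :2 :half :root :Φ :Δ : Polynomial n
      :1    = con (+ 1)
      :2    = :1 :+ :1
      :half = :2 :* t :* y :* ((x :- :1) :* t :* y :+ :1)
      :root = (x :- :1) :* t :^ 2 :* y :* (:2 :* y :- :1) :+ t :* (y :- :1) :+ :1 :- A :* :half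
      :Φ    = :1 :+ t :* ((A :+ (x :- :1) :* (t :* (y :* (A :- :1)))) :* (:1 :+ y :* (A :- :1)))
      :Δ    = t :* (:2 :* y :* (x :* (t :- :1) :* t :- t :^ 2 :- :1)
                    :+ t :* y :^ 2 :* (:- (x :* t) :+ t :+ :1) :^ 2
                    :+ t :- :2)
              :+ :1

  -- The equation A = Φ reads c A² - b A + d = 0 with 2 c = half, and root = b - 2 c A.
  root² : A ≈ Φ → Discriminant (λ s f → s * s ≈ f) _+_ _*_ _-_ -_ _^_ 1# 2# t y x root
  root² A≈Φ = begin
    -- Completing the square: `b² - 4 c d` is the discriminant, `Φ - A` is `c A² - b A + d`, and its
    -- factor `2# * half` is `4 c`.
    root * root                             ≈⟨ solve 4 (λ t y x A → let open Syntax t y x A in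
                                                 :root :* :root := :Δ :+ :2 :* :half :* (:Φ :- A)) refl t y x A ⟩
    discriminant + 2# * half * (Φ - A)      ≈⟨ +-congˡ (*-congˡ (trans (+-congʳ (sym A≈Φ)) (-‿inverseʳ A))) ⟩
    discriminant + 2# * half * 0#           ≈⟨ +-congˡ (zeroʳ (2# * half)) ⟩
    discriminant + 0#                       ≈⟨ +-identityʳ discriminant ⟩
    discriminant                            ∎

  -- `root` is the claimed quotient solved for its square root, so after cross-multiplication this
  -- is a ring identity.
  root-quotient : ∀ {F} → F ≈ A → Quotient (λ F num den → F * den ≈ num * 1#) _+_ _*_ _-_ -_ _^_ 1# 2# t y x root F
  root-quotient F≈A = trans (*-congʳ F≈A) (solve 4 (λ t y x A → let open Syntax t y x A in
    A :* :half := (:- :root :+ (x :- :1) :* t :^ 2 :* y :* (:2 :* y :- :1) :+ t :* (y :- :1) :+ :1) :* :1) refl t y x A)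

  -- Exhibits the constant term `1#`, which distinguishes the required square root from its
  -- negative.
  root≈1+t* : root ≈ 1# + t * ((x - 1#) * t * y * (2# * y - 1#) + (y - 1#)
                                - A * (2# * y * ((x - 1#) * t * y + 1#)))
  root≈1+t* = solve 4 (λ t y x A → let open Syntax t y x A in
    :root := :1 :+ t :* ((x :- :1) :* t :* y :* (:2 :* y :- :1) :+ (y :- :1)
                         :- A :* (:2 :* y :* ((x :- :1) :* t :* y :+ :1)))) refl t y x A

-- Binary trees, their enumeration and their statistics.

data Tree : Set where
  leaf : Tree
  node : (l r : Tree) → Tree

size : Tree → ℕ
size leaf       = 0
size (node l r) = suc (size l ℕ.+ size r)

-- The subtree sizes `toℕ i` and `n ∸ toℕ i` are not structurally smaller than `suc n`, so the
-- recursion runs on `fuel`. Indexing by the size of the left subtree copies the Cauchy product of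
-- power series.
forest        : (fuel n : ℕ) → List Tree
nodesWithLeft : (fuel n : ℕ) → Fin (suc n) → List Tree
forest _          zero    = leaf ∷ []
-- Dummy value: `n ≤ fuel` holds in every call that `trees` makes.
forest zero       (suc n) = []
forest (suc fuel) (suc n) = concat (tabulate (nodesWithLeft fuel n))
nodesWithLeft fuel n i = cartesianProductWith node (forest fuel (toℕ i)) (forest fuel (n ∸ toℕ i))

trees : ℕ → List Tree
trees n = forest n n

forest-fuel : ∀ k k′ n → n ≤ k → n ≤ k′ → forest k n ≡ forest k′ n
forest-fuel _       _        zero    _         _          = ≡.refl
forest-fuel (suc k) (suc k′) (suc n) (s≤s n≤k) (s≤s n≤k′) =
  ≡.cong concat (tabulate-cong λ i → ≡.cong₂ (cartesianProductWith node)
    (fuel (toℕ≤pred[n] i)) (fuel (ℕ.m∸n≤m n (toℕ i))))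
  where
  fuel : ∀ {m} → m ≤ n → forest k m ≡ forest k′ m
  fuel m≤n = forest-fuel k k′ _ (ℕ.≤-trans m≤n n≤k) (ℕ.≤-trans m≤n n≤k′)

trees-suc : ∀ n → trees (suc n) ≡ concat (tabulate {n = suc n} λ i →
  cartesianProductWith node (trees (toℕ i)) (trees (n ∸ toℕ i)))
trees-suc n = ≡.cong concat (tabulate-cong λ i → ≡.cong₂ (cartesianProductWith node)
  (fuel (toℕ≤pred[n] i)) (fuel (ℕ.m∸n≤m n (toℕ i))))
  where
  fuel : ∀ {m} → m ≤ n → forest n m ≡ trees m
  fuel m≤n = forest-fuel n _ _ m≤n ℕ.≤-refl

indicator : Bool → ℕ
indicator b = if b then 1 else 0

isNode : Tree → Bool
isNode leaf       = false
isNode (node _ _) = true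

-- Read `node l r` as `L m R` with `R` below `L` and `m`. If `R` is nonempty, its own end decides;
-- otherwise `m` is last, and it is smallest only when `L` is empty.
endsWithMin : Tree → Bool
endsWithMin leaf                  = false
endsWithMin (node l leaf)         = not (isNode l)
endsWithMin (node _ r@(node _ _)) = endsWithMin r

-- If `R` is one letter, the descent comes from `m`; if `R` is longer, it must itself end with a
-- descent, hence with its smallest letter. If `R` is empty, the maximum is last.
endsWithDescent : Tree → Bool
endsWithDescent leaf       = false
endsWithDescent (node _ r) = endsWithMin r

descents : Tree → ℕ
descents leaf       = 0
descents (node l r) = descents l ℕ.+ (indicator (isNode r) ℕ.+ descents r)

matches : Tree → ℕ
matches leaf       = 0
matches (node l r) = matches l ℕ.+ (indicator (endsWithDescent l) ℕ.+ matches r)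

-- Sums over lists.

module FiniteSum (R : CommutativeRing c ℓ) where
  open CommutativeRing R hiding (zero)
  open SemiringSum semiring using (sum; sum-cong-≋)
  open CommutativeSemigroupProperties +-commutativeSemigroup using (interchange; x∙yz≈y∙xz)
  open SetoidReasoning setoid

  private
    variable
      B : Set

  ∑ : (B → Carrier) → List B → Carrier
  ∑ f bs = foldr _+_ 0# (map f bs)

  ∑-cong : ∀ {f g : B → Carrier} → (∀ b → f b ≈ g b) → ∀ bs → ∑ f bs ≈ ∑ g bs
  ∑-cong f≈g []       = refl
  ∑-cong f≈g (b ∷ bs) = +-cong (f≈g b) (∑-cong f≈g bs)

  ∑-+ : ∀ (f g : B → Carrier) bs → ∑ (λ b → f b + g b) bs ≈ ∑ f bs + ∑ g bs
  ∑-+ f g []       = sym (+-identityˡ 0#)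
  ∑-+ f g (b ∷ bs) = trans (+-congˡ (∑-+ f g bs)) (interchange _ _ _ _)

  ∑-scale : ∀ a (f : B → Carrier) bs → ∑ (λ b → a * f b) bs ≈ a * ∑ f bs
  ∑-scale a f []       = sym (zeroʳ a)
  ∑-scale a f (b ∷ bs) = trans (+-congˡ (∑-scale a f bs)) (sym (distribˡ a _ _))

  ∑-++ : ∀ (f : B → Carrier) bs bs′ → ∑ f (bs ++ bs′) ≈ ∑ f bs + ∑ f bs′
  ∑-++ f []       bs′ = sym (+-identityˡ _)
  ∑-++ f (b ∷ bs) bs′ = trans (+-congˡ (∑-++ f bs bs′)) (sym (+-assoc _ _ _))

  ∑-map : ∀ {C : Set} (f : C → Carrier) (g : B → C) bs → ∑ f (map g bs) ≈ ∑ (f ∘ g) bs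
  ∑-map f g []       = refl
  ∑-map f g (b ∷ bs) = +-congˡ (∑-map f g bs)

  ∑-↭ : ∀ (f : B → Carrier) {bs bs′} → bs ↭ bs′ → ∑ f bs ≈ ∑ f bs′
  ∑-↭ f ↭.refl                 = refl
  ∑-↭ f (↭.prep b bs↭bs′)      = +-congˡ (∑-↭ f bs↭bs′)
  ∑-↭ f (↭.swap b c bs↭bs′)    = trans (+-congˡ (+-congˡ (∑-↭ f bs↭bs′))) (x∙yz≈y∙xz _ _ _)
  ∑-↭ f (↭.trans bs↭cs cs↭bs′) = trans (∑-↭ f bs↭cs) (∑-↭ f cs↭bs′)

  ∑-concat-tabulate : ∀ (f : B → Carrier) n (F : Fin n → List B) →
                      ∑ f (concat (tabulate F)) ≈ sum (λ i → ∑ f (F i))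
  ∑-concat-tabulate f zero    F = refl
  ∑-concat-tabulate f (suc n) F = trans (∑-++ f (F zero) (concat (tabulate (F ∘ suc))))
                                        (+-congˡ (∑-concat-tabulate f n (F ∘ suc)))

  ∑-cartesianProductWith :
    ∀ {C D : Set} (_∙_ : B → C → D) (f : D → Carrier) (p : B → Carrier) (q : C → Carrier) →
    (∀ b c → f (b ∙ c) ≈ p b * q c) →
    ∀ bs cs → ∑ f (cartesianProductWith _∙_ bs cs) ≈ ∑ p bs * ∑ q cs
  ∑-cartesianProductWith _∙_ f p q f∙≈p*q [] cs = sym (zeroˡ _)
  ∑-cartesianProductWith _∙_ f p q f∙≈p*q (b ∷ bs) cs = begin
    ∑ f (map (b ∙_) cs ++ cartesianProductWith _∙_ bs cs)
      ≈⟨ ∑-++ f (map (b ∙_) cs) _ ⟩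
    ∑ f (map (b ∙_) cs) + ∑ f (cartesianProductWith _∙_ bs cs)
      ≈⟨ +-cong (∑-map f (b ∙_) cs) (∑-cartesianProductWith _∙_ f p q f∙≈p*q bs cs) ⟩
    ∑ (λ c → f (b ∙ c)) cs + ∑ p bs * ∑ q cs
      ≈⟨ +-congʳ (∑-cong (f∙≈p*q b) cs) ⟩
    ∑ (λ c → p b * q c) cs + ∑ p bs * ∑ q cs
      ≈⟨ +-congʳ (∑-scale (p b) q cs) ⟩
    p b * ∑ q cs + ∑ p bs * ∑ q cs
      ≈⟨ distribʳ _ _ _ ⟨
    ∑ p (b ∷ bs) * ∑ q cs
      ∎

-- Eliminating the auxiliary series.

module Elimination (S : CommutativeRing c ℓ) where
  open import Data.Integer.Base using (+_)
  open CommutativeRing S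
  open SetoidReasoning setoid
  open IntegerCoefficientSolver S using (solve; con; _:+_; _:*_; _:-_; _:=_)

  -- `fixpoint-unique` is where `t` acts as the variable of a power series ring; the other
  -- hypotheses are plain equations between ring elements. `P-eq` and `G-eq` are cleared of
  -- subtraction, so that they can be checked tree by tree.
  module _ {t y x A P G E D Δ E₁ : Carrier}
    (fixpoint-unique : ∀ a c f g → f ≈ a + t * (c * f) → g ≈ a + t * (c * g) → f ≈ g)
    (A-eq : A ≈ 1# + t * (P * G))
    (G-eq : G + y * Δ ≈ Δ + y * A)
    (P-eq : P + E ≈ A + x * E)
    (E-eq : E ≈ t * (P * (y * D)))
    (D-eq : D ≈ E + E₁)
    (E₁-eq : E₁ ≈ t * (Δ * Δ))
    (Δ≈1 : Δ ≈ 1#)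
    where
    private
      E₁≈t : E₁ ≈ t
      E₁≈t = begin
        E₁                   ≈⟨ E₁-eq ⟩
        t * (Δ * Δ)          ≈⟨ *-congˡ (*-cong Δ≈1 Δ≈1) ⟩
        t * (1# * 1#)        ≈⟨ solve 1 (λ t → t :* (con (+ 1) :* con (+ 1)) := t) refl t ⟩
        t                    ∎

      G≈ : G ≈ 1# + y * (A - 1#)
      G≈ = begin
        G                        ≈⟨ solve 2 (λ g y → g := (g :+ y :* con (+ 1)) :- y) refl G y ⟩
        (G + y * 1#) - y         ≈⟨ +-congʳ (+-congˡ (*-congˡ Δ≈1)) ⟨
        (G + y * Δ) - y          ≈⟨ +-congʳ (trans G-eq (+-congʳ Δ≈1)) ⟩
        (1# + y * A) - y         ≈⟨ solve 2 (λ y A → (con (+ 1) :+ y :* A) :- y := con (+ 1) :+ y :* (A :- con (+ 1))) refl y A ⟩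
        1# + y * (A - 1#)        ∎

      -- By fixpoint-unique, D-fix and tG-fix together give D ≈ t * G.
      D-fix : D ≈ t + t * (P * y * D)
      D-fix = begin
        D                              ≈⟨ D-eq ⟩
        E + E₁                         ≈⟨ +-cong E-eq E₁≈t ⟩
        t * (P * (y * D)) + t          ≈⟨ solve 4 (λ t P y D → t :* (P :* (y :* D)) :+ t := t :+ t :* (P :* y :* D)) refl t P y D ⟩
        t + t * (P * y * D)            ∎

      tG-fix : t * G ≈ t + t * (P * y * (t * G))
      tG-fix = begin
        t * G                                      ≈⟨ *-congˡ G≈ ⟩
        t * (1# + y * (A - 1#))                    ≈⟨ *-congˡ (+-congˡ (*-congˡ (+-congʳ A-eq))) ⟩
        t * (1# + y * ((1# + t * (P * G)) - 1#))   ≈⟨ solve 4 (λ t P y G →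
          t :* (con (+ 1) :+ y :* ((con (+ 1) :+ t :* (P :* G)) :- con (+ 1))) := t :+ t :* (P :* y :* (t :* G))) refl t P y G ⟩
        t + t * (P * y * (t * G))                  ∎

      E≈ : E ≈ t * (y * (A - 1#))
      E≈ = begin
        E                               ≈⟨ solve 2 (λ e t → e := (e :+ t) :- t) refl E t ⟩
        (E + t) - t                     ≈⟨ +-congʳ (trans D-eq (+-congˡ E₁≈t)) ⟨
        D - t                           ≈⟨ +-congʳ (fixpoint-unique t (P * y) D (t * G) D-fix tG-fix) ⟩
        t * G - t                       ≈⟨ +-congʳ (*-congˡ G≈) ⟩
        t * (1# + y * (A - 1#)) - t     ≈⟨ solve 3 (λ t y A → t :* (con (+ 1) :+ y :* (A :- con (+ 1))) :- t := t :* (y :* (A :- con (+ 1)))) refl t y A ⟩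
        t * (y * (A - 1#))              ∎

      P≈ : P ≈ A + (x - 1#) * E
      P≈ = begin
        P                    ≈⟨ solve 2 (λ p e → p := (p :+ e) :- e) refl P E ⟩
        (P + E) - E          ≈⟨ +-congʳ P-eq ⟩
        (A + x * E) - E      ≈⟨ solve 3 (λ A x E → (A :+ x :* E) :- E := A :+ (x :- con (+ 1)) :* E) refl A x E ⟩
        A + (x - 1#) * E     ∎

    A≈Φ : A ≈ SquareRoot.Φ S t y x A
    A≈Φ = trans A-eq (+-congˡ (*-congˡ (*-cong (trans P≈ (+-congˡ (*-congˡ E≈))) G≈)))

-- Generating series over trees and their functional equation.

module TreeSeries (R : CommutativeRing c ℓ) (x y : CommutativeRing.Carrier R) where
  private
    module R = CommutativeRing R
    module S = CommutativeRing (PowerSeriesRing.commutativeRing R)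
    module PS = PowerSeriesRing R
  open FiniteSum R
  open SemiringSum R.semiring using (sum-cong-≋)
  open SemiringExp R.semiring using (_^_; ^-homo-*)

  series : (Tree → R.Carrier) → S.Carrier
  series f n = ∑ f (trees n)

  series-cong : ∀ {f g} → (∀ τ → f τ R.≈ g τ) → series f S.≈ series g
  series-cong f≈g n = ∑-cong f≈g (trees n)

  series-+ : ∀ f g → series (λ τ → f τ R.+ g τ) S.≈ series f S.+ series g
  series-+ f g n = ∑-+ f g (trees n)

  series-scale : ∀ a f → series (λ τ → a R.* f τ) S.≈ PS.const a S.* series f
  series-scale a f n = R.trans (∑-scale a f (trees n)) (R.sym (PS.const-⊛ a (series f) n))

  -- The trees of size `suc n` are grouped by the size of the left subtree, as the terms of a Cauchy
  -- product are by index, and on each group a weight that factors over the two subtrees sums to a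
  -- product.
  series-node : ∀ {f} p q → (∀ l r → f (node l r) R.≈ p l R.* q r) →
                ∀ n → series f (suc n) R.≈ (series p S.* series q) n
  series-node {f} p q f≈p*q n = begin
    ∑ f (trees (suc n))                    ≡⟨ ≡.cong (∑ f) (trees-suc n) ⟩
    ∑ f (concat (tabulate {n = suc n} λ i → cartesianProductWith node (trees (toℕ i)) (trees (n ∸ toℕ i))))
                                           ≈⟨ ∑-concat-tabulate f (suc n) (λ i → cartesianProductWith node (trees (toℕ i)) (trees (n ∸ toℕ i))) ⟩
    _                                      ≈⟨ sum-cong-≋ {n = suc n} (λ i → ∑-cartesianProductWith node f p q f≈p*q (trees (toℕ i)) (trees (n ∸ toℕ i))) ⟩
    (series p S.* series q) n              ∎
    where open SetoidReasoning R.setoid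

  series-leaf-node : ∀ {f} a p q → f leaf R.≈ a → (∀ l r → f (node l r) R.≈ p l R.* q r) →
                     series f S.≈ PS.const a S.+ PS.X S.* (series p S.* series q)
  series-leaf-node {f} a p q f≈a f≈p*q zero = begin
    f leaf R.+ R.0#                         ≈⟨ R.+-cong f≈a (R.sym (R.trans (R.+-identityʳ _) (R.zeroˡ _))) ⟩
    a R.+ (R.0# R.* (series p S.* series q) 0 R.+ R.0#) ∎
    where open SetoidReasoning R.setoid
  series-leaf-node {f} a p q f≈a f≈p*q (suc n) = begin
    series f (suc n)                        ≈⟨ series-node p q f≈p*q n ⟩
    (series p S.* series q) n               ≈⟨ PS.X-⊛-suc (series p S.* series q) n ⟨
    (PS.X S.* (series p S.* series q)) (suc n) ≈⟨ R.+-identityˡ _ ⟨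
    R.0# R.+ (PS.X S.* (series p S.* series q)) (suc n) ∎
    where open SetoidReasoning R.setoid

  series-leafless-node : ∀ {f} p q → f leaf R.≈ R.0# → (∀ l r → f (node l r) R.≈ p l R.* q r) →
                         series f S.≈ PS.X S.* (series p S.* series q)
  series-leafless-node p q f≈0 f≈p*q n = R.trans (series-leaf-node R.0# p q f≈0 f≈p*q n)
    (R.trans (R.+-congʳ (const-0 n)) (R.+-identityˡ _))
    where
    const-0 : PS.const R.0# S.≈ S.0#
    const-0 zero    = R.refl
    const-0 (suc n) = R.refl

  -- The factor `PS.X` makes the coefficient at `suc n` depend only on the coefficients of the
  -- solution up to `n`. All of these are needed, hence the induction on a bound `m`.
  fixpoint-unique : ∀ {a c f g} → f S.≈ a S.+ PS.X S.* (c S.* f) → g S.≈ a S.+ PS.X S.* (c S.* g) → f S.≈ g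
  fixpoint-unique {a} {c} {f} {g} f-fix g-fix n = below n n ℕ.≤-refl
    where
    below : ∀ m n → n ≤ m → f n R.≈ g n
    below m       zero    _         = R.trans (f-fix 0) (R.trans
      (R.+-congˡ (R.+-congʳ (R.trans (R.zeroˡ _) (R.sym (R.zeroˡ _))))) (R.sym (g-fix 0)))
    below (suc m) (suc n) (s≤s n≤m) = begin
      f (suc n)                                      ≈⟨ f-fix (suc n) ⟩
      a (suc n) R.+ (PS.X S.* (c S.* f)) (suc n)     ≈⟨ R.+-congˡ (PS.X-⊛-suc (c S.* f) n) ⟩
      a (suc n) R.+ (c S.* f) n                      ≈⟨ R.+-congˡ (sum-cong-≋ {n = suc n} λ i → R.*-congˡ {c (toℕ i)} (below m (n ∸ toℕ i) (ℕ.≤-trans (ℕ.m∸n≤m n (toℕ i)) n≤m))) ⟩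
      a (suc n) R.+ (c S.* g) n                      ≈⟨ R.+-congˡ (PS.X-⊛-suc (c S.* g) n) ⟨
      a (suc n) R.+ (PS.X S.* (c S.* g)) (suc n)     ≈⟨ g-fix (suc n) ⟨
      g (suc n)                                      ∎
      where open SetoidReasoning R.setoid

  weight : Tree → R.Carrier
  weight τ = y ^ descents τ R.* x ^ matches τ

  private
    _when_ : R.Carrier → Bool → R.Carrier
    a when b = if b then a else R.0#

    -- p and q are the factors of weight (node l r) due to l and r.  e and d
    -- restrict weight to the words ending with a descent, respectively with
    -- their smallest letter; d exceeds e by e₁, the tree with a single node.
    δ p q e d e₁ : Tree → R.Carrier
    δ leaf       = R.1#
    δ (node _ _) = R.0#
    p τ = weight τ R.* x ^ indicator (endsWithDescent τ)
    q τ = y ^ indicator (isNode τ) R.* weight τ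
    e τ = weight τ when endsWithDescent τ
    d τ = weight τ when endsWithMin τ
    e₁ leaf       = R.0#
    e₁ (node l r) = δ l R.* δ r

    open import Data.Integer.Base using (+_)
    module RS = IntegerCoefficientSolver R
    open RS using (solve; con; _:+_; _:*_; _:=_)

    weight-node : ∀ l r → weight (node l r) R.≈ p l R.* q r
    weight-node l r = begin
      y ^ (descents l ℕ.+ (indicator (isNode r) ℕ.+ descents r)) R.*
      x ^ (matches l ℕ.+ (indicator (endsWithDescent l) ℕ.+ matches r))
        ≈⟨ R.*-cong (^-split (descents l) (indicator (isNode r)) (descents r))
                   (^-split (matches l) (indicator (endsWithDescent l)) (matches r)) ⟩
      _ ≈⟨ solve 6 (λ a b c d e f → (a :* (b :* c)) :* (d :* (e :* f)) := ((a :* d) :* e) :* (b :* (c :* f))) R.refl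
            (y ^ descents l) (y ^ indicator (isNode r)) (y ^ descents r)
            (x ^ matches l) (x ^ indicator (endsWithDescent l)) (x ^ matches r) ⟩
      p l R.* q r
        ∎
      where
      open SetoidReasoning R.setoid
      ^-split : ∀ {z} i j k → z ^ (i ℕ.+ (j ℕ.+ k)) R.≈ z ^ i R.* (z ^ j R.* z ^ k)
      ^-split {z} i j k = R.trans (^-homo-* z i (j ℕ.+ k)) (R.*-congˡ (^-homo-* z j k))

    -- A power of `x` with exponent `0` or `1` is `1 + (x - 1)` times that exponent; here the
    -- subtraction is moved to the other side.
    p+e : ∀ τ → p τ R.+ e τ R.≈ weight τ R.+ x R.* e τ
    p+e τ with endsWithDescent τ
    ... | true  = solve 2 (λ w x → w :* (x :* con (+ 1)) :+ w := w :+ x :* w) R.refl (weight τ) x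
    ... | false = solve 2 (λ w x → w :* con (+ 1) :+ con (+ 0) := w :+ x :* con (+ 0)) R.refl (weight τ) x

    -- The weight `q` is `1` on the leaf and `y` times `weight` on nodes, so this is
    -- `G = 1 + y (A - 1)` for a single tree, free of subtraction.
    q+yδ : ∀ τ → q τ R.+ y R.* δ τ R.≈ δ τ R.+ y R.* weight τ
    q+yδ leaf       = solve 1 (λ y → con (+ 1) :* (con (+ 1) :* con (+ 1)) :+ y :* con (+ 1)
                                  := con (+ 1) :+ y :* (con (+ 1) :* con (+ 1))) R.refl y
    q+yδ (node l r) = solve 2 (λ w y → (y :* con (+ 1)) :* w :+ y :* con (+ 0)
                                  := con (+ 0) :+ y :* w) R.refl (weight (node l r)) y

    -- A tree that ends with its smallest letter is a node, and there `q` carries exactly one extra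
    -- `y`.
    yd : ∀ r → y R.* d r R.≈ q r when endsWithMin r
    yd leaf       = R.zeroʳ y
    yd (node l r) with endsWithMin (node l r)
    ... | true  = R.sym (R.*-congʳ (R.*-identityʳ y))
    ... | false = R.zeroʳ y

    e-node : ∀ l r → e (node l r) R.≈ p l R.* (y R.* d r)
    e-node l r = R.trans (helper (endsWithMin r)) (R.*-congˡ (R.sym (yd r)))
      where
      helper : ∀ b → weight (node l r) when b R.≈ p l R.* (q r when b)
      helper true  = weight-node l r
      helper false = R.sym (R.zeroʳ _)

    -- Over a right subtree that is a node, both conditions compute to the same Boolean. Otherwise
    -- the last letter is the maximum, which is also the smallest letter only in the one-letter
    -- word.
    d≈e+e₁ : ∀ τ → d τ R.≈ e τ R.+ e₁ τ
    d≈e+e₁ leaf                       = R.sym (R.+-identityˡ _)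
    d≈e+e₁ (node leaf       leaf)     = solve 0 (con (+ 1) :* con (+ 1) := con (+ 0) :+ con (+ 1) :* con (+ 1)) R.refl
    d≈e+e₁ (node (node _ _) leaf)     = R.sym (R.trans (R.+-congˡ (R.zeroˡ _)) (R.+-identityˡ _))
    d≈e+e₁ (node l r@(node _ _))      = R.sym (R.trans (R.+-congˡ (R.zeroʳ _)) (R.+-identityʳ _))

    A P G E D E₁ Δ : S.Carrier
    A  = series weight
    P  = series p
    G  = series q
    E  = series e
    D  = series d
    E₁ = series e₁
    Δ  = series δ

    Δ≈1 : Δ S.≈ S.1#
    Δ≈1 zero    = R.+-identityʳ _
    Δ≈1 (suc n) = begin
      -- The value of `δ` on nodes is presented as the product of two zeros, so that `series-node`
      -- applies.
      Δ (suc n)                      ≈⟨ series-node (λ _ → R.0#) (λ _ → R.0#) (λ _ _ → R.sym (R.zeroˡ _)) n ⟩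
      (series (λ _ → R.0#) S.* series (λ _ → R.0#)) n
                                     ≈⟨ PS.⊛-cong {g = series (λ _ → R.0#)} (∑-zero ∘ trees) (λ _ → R.refl) n ⟩
      (S.0# S.* series (λ _ → R.0#)) n ≈⟨ PS.⊛-zeroˡ (series (λ _ → R.0#)) n ⟩
      R.0#                           ∎
      where
      open SetoidReasoning R.setoid
      ∑-zero : ∀ τs → ∑ (λ _ → R.0#) τs R.≈ R.0#
      ∑-zero []       = R.refl
      ∑-zero (_ ∷ τs) = R.trans (R.+-identityˡ _) (∑-zero τs)

    A-eq : A S.≈ S.1# S.+ PS.X S.* (P S.* G)
    A-eq = series-leaf-node R.1# p q (R.*-identityʳ _) weight-node

    E-eq : E S.≈ PS.X S.* (P S.* (PS.const y S.* D))
    E-eq n = R.trans (series-leafless-node p (λ τ → y R.* d τ) R.refl e-node n)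
      (PS.⊛-cong {f = PS.X} (λ _ → R.refl) (PS.⊛-cong {f = P} (λ _ → R.refl) (series-scale y d)) n)

    E₁-eq : E₁ S.≈ PS.X S.* (Δ S.* Δ)
    E₁-eq = series-leafless-node δ δ R.refl (λ _ _ → R.refl)

    D-eq : D S.≈ E S.+ E₁
    D-eq n = R.trans (series-cong d≈e+e₁ n) (series-+ e e₁ n)

    G-eq : G S.+ PS.const y S.* Δ S.≈ Δ S.+ PS.const y S.* A
    G-eq n = begin
      G n R.+ (PS.const y S.* Δ) n            ≈⟨ R.+-congˡ (series-scale y δ n) ⟨
      G n R.+ series (λ τ → y R.* δ τ) n      ≈⟨ series-+ q _ n ⟨
      series (λ τ → q τ R.+ y R.* δ τ) n      ≈⟨ series-cong q+yδ n ⟩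
      series (λ τ → δ τ R.+ y R.* weight τ) n ≈⟨ series-+ δ _ n ⟩
      Δ n R.+ series (λ τ → y R.* weight τ) n ≈⟨ R.+-congˡ (series-scale y weight n) ⟩
      Δ n R.+ (PS.const y S.* A) n            ∎
      where open SetoidReasoning R.setoid

    P-eq : P S.+ E S.≈ A S.+ PS.const x S.* E
    P-eq n = begin
      P n R.+ E n                               ≈⟨ series-+ p e n ⟨
      series (λ τ → p τ R.+ e τ) n              ≈⟨ series-cong p+e n ⟩
      series (λ τ → weight τ R.+ x R.* e τ) n   ≈⟨ series-+ weight _ n ⟩
      A n R.+ series (λ τ → x R.* e τ) n        ≈⟨ R.+-congˡ (series-scale x e n) ⟩
      A n R.+ (PS.const x S.* E) n              ∎
      where open SetoidReasoning R.setoid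

  functional-equation :
    series weight S.≈ SquareRoot.Φ (PowerSeriesRing.commutativeRing R) PS.X (PS.const y) (PS.const x) (series weight)
  functional-equation = Elimination.A≈Φ (PowerSeriesRing.commutativeRing R)
    {PS.X} {PS.const y} {PS.const x} {A} {P} {G} {E} {D} {Δ} {E₁}
    (λ a c f g → fixpoint-unique {a} {c} {f} {g}) A-eq G-eq P-eq E-eq D-eq E₁-eq Δ≈1

  private
    module Root = SquareRoot (PowerSeriesRing.commutativeRing R) PS.X (PS.const y) (PS.const x) (series weight)
    open SemiringExp S.semiring using () renaming (_^_ to _^ˢ_)

    root-0 : Root.root 0 R.≈ R.1#
    root-0 = R.trans (Root.root≈1+t* 0)
      (R.trans (R.+-congˡ (R.trans (R.+-identityʳ _) (R.zeroˡ _))) (R.+-identityʳ R.1#))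

  root : S.Carrier
  root = Root.root

  root-discriminant : Discriminant PS._IsSqrtOf_ S._+_ S._*_ S._-_ S.-_ _^ˢ_ S.1# Root.2# PS.X (PS.const y) (PS.const x) root
  root-discriminant = Root.root² functional-equation , root-0

  -- The proofs that the denominators are nonzero are arguments, because over an arbitrary `R`, such
  -- as the zero ring, they may fail to exist.
  IsQuotient : (F num den : S.Carrier) → Set _
  IsQuotient F num den = (1≉0 : S.1# S.≉ S.0#) (den≉0 : den S.≉ S.0#) → F / S.1# [ 1≉0 ] ≃ num / den [ den≉0 ]
    where open FractionField S.rawRing

  root-quotient : ∀ {F} → F S.≈ series weight →
    Quotient IsQuotient S._+_ S._*_ S._-_ S.-_ _^ˢ_ S.1# Root.2# PS.X (PS.const y) (PS.const x) root F
  root-quotient {F} F≈A _ _ = Root.root-quotient {F} F≈A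

-- Binary trees and 132-avoiders.

module Avoiders where
  open import Data.Nat.Base using (_+_; _<_; _<ᵇ_)
  open import Data.Nat.Properties
  open import Data.Product using (∃-syntax; _×_)
  open import Data.List.Membership.DecPropositional _≟_ using (_∈?_)
  open ≡

  -- word lo τ is a permutation of lo + 1, …, lo + size τ.
  word : ℕ → Tree → Word
  word lo leaf       = []
  word lo (node l r) = word (size r + lo) l ++ suc (size l + (size r + lo)) ∷ word lo r

  Within : (lo hi : ℕ) → Word → Set
  Within lo hi = All (λ a → lo < a × a ≤ hi)

  weaken : ∀ {lo lo′ hi hi′ w} → lo′ ≤ lo → hi ≤ hi′ → Within lo hi w → Within lo′ hi′ w
  weaken lo′≤lo hi≤hi′ = All.map λ (lo<a , a≤hi) → ≤-<-trans lo′≤lo lo<a , ≤-trans a≤hi hi≤hi′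

  length-word : ∀ lo τ → length (word lo τ) ≡ size τ
  length-word lo leaf       = refl
  length-word lo (node l r) = begin
    length (word (size r + lo) l ++ _ ∷ word lo r)       ≡⟨ length-++ (word (size r + lo) l) ⟩
    length (word (size r + lo) l) + suc (length (word lo r)) ≡⟨ cong₂ (λ i j → i + suc j) (length-word _ l) (length-word lo r) ⟩
    size l + suc (size r)                                ≡⟨ +-suc (size l) (size r) ⟩
    suc (size l + size r)                                ∎
    where open ≡-Reasoning

  word-within : ∀ lo τ → Within lo (size τ + lo) (word lo τ)
  word-within lo leaf       = []
  word-within lo (node l r) = All.++⁺
    (weaken (m≤n+m lo (size r)) (m≤n⇒m≤1+n (≤-reflexive assoc)) (word-within (size r + lo) l))
    ((s≤s (≤-trans (m≤n+m lo (size r)) (m≤n+m _ (size l))) , s≤s (≤-reflexive assoc))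
     ∷ weaken ≤-refl (m≤n⇒m≤1+n (≤-trans (m≤n+m _ (size l)) (≤-reflexive assoc))) (word-within lo r))
    where
    assoc : size l + (size r + lo) ≡ size l + size r + lo
    assoc = sym (+-assoc (size l) (size r) lo)

  within⇒below : ∀ {lo hi w} → Within lo hi w → All (_< suc hi) w
  within⇒below = All.map (s≤s ∘ proj₂)

  wordˡ-below : ∀ lo l r → All (_< suc (size l + (size r + lo))) (word (size r + lo) l)
  wordˡ-below lo l r = within⇒below (word-within (size r + lo) l)

  wordʳ-below : ∀ lo l r → All (_< suc (size l + (size r + lo))) (word lo r)
  wordʳ-below lo l r = within⇒below (weaken ≤-refl (m≤n+m _ (size l)) (word-within lo r))

  -- Every letter of `L` and `L′` is below `m`, so the first occurrence of `m` is the same cut in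
  -- both words.
  ++-∷-injective : ∀ {m} {L L′ R R′ : Word} → All (_< m) L → All (_< m) L′ →
                   L ++ m ∷ R ≡ L′ ++ m ∷ R′ → L ≡ L′ × R ≡ R′
  ++-∷-injective []          []           refl = refl , refl
  ++-∷-injective []          (m<m ∷ _)    refl = contradiction m<m (<-irrefl refl)
  ++-∷-injective (m<m ∷ _)   []           refl = contradiction m<m (<-irrefl refl)
  ++-∷-injective (_ ∷ L<m)   (_ ∷ L′<m)   eq with ++-∷-injective L<m L′<m (cong (drop 1) eq) | cong (take 1) eq
  ... | refl , refl | refl = refl , refl

  word-injective : ∀ lo τ τ′ → word lo τ ≡ word lo τ′ → τ ≡ τ′
  word-injective lo τ τ′ eq = go lo τ τ′ size≡ eq
    where
    size≡ : size τ ≡ size τ′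
    size≡ = trans (sym (length-word lo τ)) (trans (cong length eq) (length-word lo τ′))
    go : ∀ lo τ τ′ → size τ ≡ size τ′ → word lo τ ≡ word lo τ′ → τ ≡ τ′
    go lo leaf       leaf         _     _  = refl
    go lo (node l r) (node l′ r′) size≡ eq = helper l≡ r≡
      where
      max≡ : size l + (size r + lo) ≡ size l′ + (size r′ + lo)
      max≡ = trans (sym (+-assoc (size l) _ _)) (trans (cong (_+ lo) (suc-injective size≡)) (+-assoc (size l′) _ _))
      parts = ++-∷-injective (wordˡ-below lo l r) (subst (λ m → All (_< suc m) (word (size r′ + lo) l′)) (sym max≡) (wordˡ-below lo l′ r′))
                (subst (λ m → word lo (node l r) ≡ word (size r′ + lo) l′ ++ suc m ∷ word lo r′) (sym max≡) eq)
      l≡ = proj₁ parts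
      r≡ = word-injective lo r r′ (proj₂ parts)
      -- Only once `r ≡ r′` is known do the two left words start at the same offset, as the
      -- injectivity for `l` requires.
      helper : word (size r + lo) l ≡ word (size r′ + lo) l′ → r ≡ r′ → node l r ≡ node l′ r′
      helper eqˡ refl = cong (λ l → node l r) (word-injective (size r + lo) l l′ eqˡ)

  word-unique : ∀ lo τ → Unique (word lo τ)
  word-unique lo leaf       = []
  word-unique lo (node l r) = AllPairs.++⁺ (word-unique _ l)
    (All.map (λ a<m → <⇒≢ a<m ∘ sym) (wordʳ-below lo l r) ∷ word-unique lo r)
    (All.zipWith (λ { (a<m , lo<a , _) → <⇒≢ a<m ∷ All.map (λ (_ , b≤) → <⇒≢ (≤-<-trans b≤ lo<a) ∘ sym) (word-within lo r) })
      (wordˡ-below lo l r , word-within (size r + lo) l))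

  -- 132-avoidance in terms of the order of letters.

  Avoids132 : Word → Set
  Avoids132 σ = ∀ {a b c} → a ∷ b ∷ c ∷ [] ⊆ σ → a < c → ¬ c < b

  ⊆-++⁻ : ∀ xs {ys u : Word} → u ⊆ xs ++ ys → ∃[ v ] ∃[ w ] (u ≡ v ++ w × v ⊆ xs × w ⊆ ys)
  ⊆-++⁻ []       s          = [] , _ , refl , [] , s
  ⊆-++⁻ (x ∷ xs) (_ ∷ʳ s)   = let v , w , u≡ , v⊆ , w⊆ = ⊆-++⁻ xs s in v , w , u≡ , x ∷ʳ v⊆ , w⊆
  ⊆-++⁻ (x ∷ xs) (refl ∷ s) = let v , w , u≡ , v⊆ , w⊆ = ⊆-++⁻ xs s in x ∷ v , w , cong (x ∷_) u≡ , refl ∷ v⊆ , w⊆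

  -- Suppose `a b c` is a 132. With `a` in `L` and `c` in `R`, `c < a`; `m` as `a` exceeds `c`; `m`
  -- as `c` exceeds `b`. What remains lies inside `L` or inside `R`.
  avoids132-++-∷ : ∀ L {m R} → All (_< m) L → All (_< m) R → All (λ l → All (_< l) R) L →
                   Avoids132 L → Avoids132 R → Avoids132 (L ++ m ∷ R)
  avoids132-++-∷ L L<m R<m R<L avL avR s a<c c<b with ⊆-++⁻ L s
  ... | []             , _ , refl , _ , _ ∷ʳ abc⊆R  = avR abc⊆R a<c c<b
  ... | []             , _ , refl , _ , refl ∷ bc⊆R = <-asym a<c (All.lookup R<m (to∈ (⊆-trans (_ ∷ʳ ⊆-refl) bc⊆R)))
  ... | _ ∷ []         , _ , refl , a⊆L , _ ∷ʳ bc⊆R = <-asym a<c (All.lookup (All.lookup R<L (to∈ a⊆L)) (to∈ (⊆-trans (_ ∷ʳ ⊆-refl) bc⊆R)))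
  ... | _ ∷ []         , _ , refl , a⊆L , refl ∷ c⊆R = <-asym a<c (All.lookup (All.lookup R<L (to∈ a⊆L)) (to∈ c⊆R))
  ... | _ ∷ _ ∷ []     , _ , refl , ab⊆L , _ ∷ʳ c⊆R  = <-asym a<c (All.lookup (All.lookup R<L (to∈ ab⊆L)) (to∈ c⊆R))
  ... | _ ∷ _ ∷ []     , _ , refl , ab⊆L , refl ∷ _  = <-asym c<b (All.lookup L<m (to∈ (⊆-trans (_ ∷ʳ ⊆-refl) ab⊆L)))
  ... | _ ∷ _ ∷ _ ∷ [] , _ , refl , abc⊆L , _        = avL abc⊆L a<c c<b

  word-avoids132 : ∀ lo τ → Avoids132 (word lo τ)
  word-avoids132 lo leaf ()
  word-avoids132 lo (node l r) = avoids132-++-∷ (word (size r + lo) l) (wordˡ-below lo l r) (wordʳ-below lo l r)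
    (All.map (λ (lo<a , _) → All.map (λ (_ , b≤) → ≤-<-trans b≤ lo<a) (word-within lo r)) (word-within (size r + lo) l))
    (word-avoids132 _ l) (word-avoids132 lo r)

  rank : ℕ → Word → ℕ
  rank a w = length (filter (_≤? a) w)

  rank-accept : ∀ {a b} w → b ≤ a → rank a (b ∷ w) ≡ suc (rank a w)
  rank-accept {a} w b≤a = cong length (filter-accept (_≤? a) b≤a)

  rank-reject : ∀ {a b} w → a < b → rank a (b ∷ w) ≡ rank a w
  rank-reject {a} w a<b = cong length (filter-reject (_≤? a) (<⇒≱ a<b))

  rank-∷ : ∀ a b w → rank a w ≤ rank a (b ∷ w)
  rank-∷ a b w with b ≤? a
  ... | yes b≤a = ≤-trans (n≤1+n _) (≤-reflexive (sym (rank-accept w b≤a)))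
  ... | no  b≰a = ≤-reflexive (sym (rank-reject w (≰⇒> b≰a)))

  red-132 : ∀ {a b c} → a < c → c < b → red (a ∷ b ∷ c ∷ []) ≡ 1 ∷ 3 ∷ 2 ∷ []
  red-132 {a} {b} {c} a<c c<b = cong₂ _∷_
    (trans (rank-accept (b ∷ c ∷ []) (≤-refl {a})) (cong suc (trans (rank-reject (c ∷ []) a<b) (rank-reject [] a<c))))
    (cong₂ _∷_
    (trans (rank-accept (b ∷ c ∷ []) (<⇒≤ a<b)) (cong suc (trans (rank-accept (c ∷ []) ≤-refl) (cong suc (rank-accept [] (<⇒≤ c<b))))))
    (cong (_∷ [])
    (trans (rank-accept (b ∷ c ∷ []) (<⇒≤ a<c)) (cong suc (trans (rank-reject (c ∷ []) c<b) (rank-accept [] (≤-refl {c})))))))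
    where
    a<b = <-trans a<c c<b

  -- Two of the ranks suffice: `c ≤ a` would give `a` a rank of at least `2`, and `b ≤ c` would give
  -- `c` rank `3`.
  red-132⁻ : ∀ {a b c} → red (a ∷ b ∷ c ∷ []) ≡ 1 ∷ 3 ∷ 2 ∷ [] → a < c × c < b
  red-132⁻ {a} {b} {c} eq = a<c , c<b
    where
    rankᵃ : rank a (a ∷ b ∷ c ∷ []) ≡ 1
    rankᵃ = cong (λ { (i ∷ _) → i ; _ → 0 }) eq
    rankᶜ : rank c (a ∷ b ∷ c ∷ []) ≡ 2
    rankᶜ = cong (λ { (_ ∷ _ ∷ i ∷ _) → i ; _ → 0 }) eq
    a<c : a < c
    a<c = ≰⇒> λ c≤a → <-irrefl (sym rankᵃ) (begin
      2                              ≡⟨ cong suc (rank-accept [] c≤a) ⟨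
      suc (rank a (c ∷ []))          ≤⟨ s≤s (rank-∷ a b (c ∷ [])) ⟩
      suc (rank a (b ∷ c ∷ []))      ≡⟨ rank-accept (b ∷ c ∷ []) ≤-refl ⟨
      rank a (a ∷ b ∷ c ∷ [])        ∎)
      where open ≤-Reasoning
    c<b : c < b
    c<b = ≰⇒> λ b≤c → <-irrefl (sym rankᶜ) (≤-reflexive (sym
      (trans (rank-accept (b ∷ c ∷ []) (<⇒≤ a<c)) (cong suc (trans (rank-accept (c ∷ []) b≤c) (cong suc (rank-accept [] (≤-refl {c}))))))))

  avoids⇒avoids132 : ∀ {σ} → σ Avoids (1 ∷ 3 ∷ 2 ∷ []) → Avoids132 σ
  avoids⇒avoids132 av abc⊆ a<c c<b = av (_ , abc⊆ , red-132 a<c c<b)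

  avoids132⇒avoids : ∀ {σ} → Avoids132 σ → σ Avoids (1 ∷ 3 ∷ 2 ∷ [])
  avoids132⇒avoids av (a ∷ b ∷ c ∷ [] , abc⊆ , eq) = let a<c , c<b = red-132⁻ eq in av abc⊆ a<c c<b
  avoids132⇒avoids av (_ ∷ [] , _ , ())
  avoids132⇒avoids av (_ ∷ _ ∷ [] , _ , ())
  avoids132⇒avoids av (_ ∷ _ ∷ _ ∷ _ ∷ _ , _ , ())

  -- Decoding: every 132-avoider is the word of a tree.

  Unique-resp-⊆ : ∀ {v w : Word} → v ⊆ w → Unique w → Unique v
  Unique-resp-⊆ []         []       = []
  Unique-resp-⊆ (_ ∷ʳ s)   (_ ∷ !w) = Unique-resp-⊆ s !w
  Unique-resp-⊆ (refl ∷ s) (a∉ ∷ !w) = All-resp-⊆ s a∉ ∷ Unique-resp-⊆ s !w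

  unique-++-∷⁻ : ∀ (L : Word) {m R} → Unique (L ++ m ∷ R) → All (_≢ m) L × All (_≢ m) R
  unique-++-∷⁻ []      (m∉R ∷ _) = [] , All.map (_∘ sym) m∉R
  unique-++-∷⁻ (a ∷ L) (a∉ ∷ !w) with All.++⁻ʳ L a∉ | unique-++-∷⁻ L !w
  ... | a≢m ∷ _ | L∌m , R∌m = a≢m ∷ L∌m , R∌m

  drop-max : ∀ {lo n w} → Within lo (suc n) w → All (_≢ suc n) w → Within lo n w
  drop-max within ≢max = All.zipWith (λ { ((lo<a , a≤) , a≢) → lo<a , ≤-pred (≤∧≢⇒< a≤ a≢) }) (within , ≢max)

  -- Pigeonhole principle, by induction on the width: the top value of the interval is either absent
  -- or can be cut out of the word.
  length≤width : ∀ lo n {w} → Unique w → Within lo (n + lo) w → length w ≤ n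
  length≤width lo zero    {[]}    _  _               = z≤n
  length≤width lo zero    {_ ∷ _} _  ((lo<a , a≤lo) ∷ _) = contradiction lo<a (≤⇒≯ a≤lo)
  length≤width lo (suc n) {w}     !w within with suc (n + lo) ∈? w
  ... | no  m∉w = m≤n⇒m≤1+n (length≤width lo n !w
                    (drop-max within (All.tabulate λ a∈w a≡m → m∉w (subst (_∈ w) a≡m a∈w))))
  ... | yes m∈w with ∈-∃++ m∈w
  ... | L , R , refl = begin
    length (L ++ m ∷ R)          ≡⟨ length-++ L ⟩
    length L + suc (length R)    ≡⟨ +-suc (length L) (length R) ⟩
    suc (length L + length R)    ≡⟨ cong suc (length-++ L) ⟨
    suc (length (L ++ R))        ≤⟨ s≤s (length≤width lo n (Unique-resp-⊆ LR⊆ !w)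
                                      (drop-max (All-resp-⊆ LR⊆ within) (All.++⁺ (proj₁ ≢m) (proj₂ ≢m)))) ⟩
    suc n                        ∎
    where
    open ≤-Reasoning
    m = suc (n + lo)
    LR⊆ : L ++ R ⊆ L ++ m ∷ R
    LR⊆ = ++⁺ (⊆-refl {x = L}) (m ∷ʳ ⊆-refl)
    ≢m = unique-++-∷⁻ L !w

  length+lo≤hi : ∀ {lo hi w} → lo ≤ hi → Unique w → Within lo hi w → length w + lo ≤ hi
  length+lo≤hi {lo} {hi} {w} lo≤hi !w within = begin
    length w + lo       ≤⟨ +-monoˡ-≤ lo (length≤width lo (hi ∸ lo) !w (weaken ≤-refl (≤-reflexive (sym hi≡)) within)) ⟩
    hi ∸ lo + lo        ≡⟨ hi≡ ⟩
    hi                  ∎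
    where
    open ≤-Reasoning
    hi≡ = m∸n+n≡m lo≤hi

  -- Distinct letters in an interval as wide as the word is long form a permutation of that
  -- interval; that every value occurs follows by counting and need not be stored.
  record IsAvoider (lo : ℕ) (σ : Word) : Set where
    constructor avoider
    field
      unique : Unique σ
      within : Within lo (length σ + lo) σ
      avoids : Avoids132 σ

  -- Avoidance puts `R` below `L`, and counting letters then forces each part to fill its own
  -- interval.
  split-avoider : ∀ {lo} (L R : Word) → IsAvoider lo (L ++ suc (length L + (length R + lo)) ∷ R) →
                  IsAvoider (length R + lo) L × IsAvoider lo R
  split-avoider {lo} L R (avoider unique within avoids) =
    avoider !L (All.tabulate λ l∈L → l-above l∈L , proj₂ (All.lookup L-within l∈L)) (avoids ∘ λ s → ⊆-trans s L⊆) ,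
    avoider !R (All.tabulate λ r∈R → proj₁ (All.lookup R-within r∈R) , r-below r∈R) (avoids ∘ λ s → ⊆-trans s R⊆)
    where
    m = suc (length L + (length R + lo))

    length≡ : length (L ++ m ∷ R) + lo ≡ m
    length≡ = trans (cong (_+ lo) (trans (length-++ L) (+-suc (length L) (length R))))
                    (cong suc (+-assoc (length L) (length R) lo))

    L⊆ : L ⊆ L ++ m ∷ R
    L⊆ = ++⁺ʳ (m ∷ R) ⊆-refl

    R⊆ : R ⊆ L ++ m ∷ R
    R⊆ = ++⁺ˡ L (m ∷ʳ ⊆-refl)

    within-m : ∀ {w} → w ⊆ L ++ m ∷ R → All (_≢ m) w → Within lo (length L + (length R + lo)) w
    within-m w⊆ = drop-max (weaken ≤-refl (≤-reflexive length≡) (All-resp-⊆ w⊆ within))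

    L-within : Within lo (length L + (length R + lo)) L
    L-within = within-m L⊆ (proj₁ (unique-++-∷⁻ L unique))

    R-within : Within lo (length L + (length R + lo)) R
    R-within = within-m R⊆ (proj₂ (unique-++-∷⁻ L unique))

    !L : Unique L
    !L = Unique-resp-⊆ L⊆ unique

    !R : Unique R
    !R = Unique-resp-⊆ R⊆ unique

    R<L : ∀ {l r} → l ∈ L → r ∈ R → r < l
    -- With `l < r` the letters `l`, `m`, `r` would form a 132.
    R<L {l} {r} l∈L r∈R = ≰⇒> λ l≤r → avoids (++⁺ (from∈ l∈L) (refl ∷ from∈ r∈R))
      (≤∧≢⇒< l≤r (disjoint l∈L r∈R)) (s≤s (proj₂ (All.lookup R-within r∈R)))
      where
      disjoint : ∀ {l r} → l ∈ L → r ∈ R → l ≢ r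
      disjoint l∈L r∈R refl = go L l∈L unique
        where
        go : ∀ L → _ ∈ L → ¬ Unique (L ++ m ∷ R)
        go (_ ∷ L) (here refl) (l∉ ∷ _) = All.lookup l∉ (∈-++⁺ʳ L (there r∈R)) refl
        go (_ ∷ L) (there l∈L) (_ ∷ !w) = go L l∈L !w

    l-above : ∀ {l} → l ∈ L → length R + lo < l
    -- The distinct letters of `R` lie above `lo` and below `suc l`, so at most `l ∸ lo` of them
    -- fit.
    l-above {suc l} l∈L = s≤s (length+lo≤hi (≤-pred (proj₁ (All.lookup L-within l∈L))) !R
      (All.tabulate λ r∈R → proj₁ (All.lookup R-within r∈R) , ≤-pred (R<L l∈L r∈R)))
    l-above {zero}  l∈L = contradiction (proj₁ (All.lookup L-within l∈L)) λ ()

    r-below : ∀ {r} → r ∈ R → r ≤ length R + lo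
    -- Dually, the distinct letters of `L` lie above `r` and up to `length L + (length R + lo)`;
    -- counting them and cancelling `length L` bounds `r`.
    r-below {r} r∈R = +-cancelˡ-≤ (length L) _ _ (length+lo≤hi (proj₂ (All.lookup R-within r∈R)) !L
      (All.tabulate λ l∈L → R<L l∈L r∈R , proj₂ (All.lookup L-within l∈L)))

  word-node : ∀ lo l r {L R} → word lo r ≡ R → word (length R + lo) l ≡ L →
              word lo (node l r) ≡ L ++ suc (length L + (length R + lo)) ∷ R
  word-node lo l r refl refl
    rewrite length-word lo r | length-word (size r + lo) l = refl

  decode : ∀ fuel lo σ → length σ ≤ fuel → IsAvoider lo σ → ∃[ τ ] word lo τ ≡ σ
  decode _ lo [] _ _ = leaf , refl
  decode (suc fuel) lo σ@(_ ∷ _) (s≤s n≤fuel) σ-avoider@(avoider !σ within av) with length σ + lo ∈? σ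
  -- Without the top value, `length σ` distinct letters would fit into an interval one shorter.
  ... | no  m∉σ = contradiction
    (length≤width lo _ !σ (drop-max within (All.tabulate λ a∈σ a≡m → m∉σ (subst (_∈ σ) a≡m a∈σ))))
    (<⇒≱ ≤-refl)
  ... | yes m∈σ with ∈-∃++ m∈σ
  ... | L , R , σ≡ = node (proj₁ l) (proj₁ r) , trans (word-node lo (proj₁ l) (proj₁ r) (proj₂ r) (proj₂ l)) (sym σ≡′)
    where
    length-σ : length σ ≡ suc (length L + length R)
    length-σ = trans (cong length σ≡) (trans (length-++ L) (+-suc (length L) (length R)))
    σ≡′ : σ ≡ L ++ suc (length L + (length R + lo)) ∷ R
    σ≡′ = trans σ≡ (cong (λ m → L ++ m ∷ R) (trans (cong (_+ lo) length-σ) (cong suc (+-assoc (length L) (length R) lo))))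
    split = split-avoider L R (subst (IsAvoider lo) σ≡′ σ-avoider)
    |L|+|R|≤fuel : length L + length R ≤ fuel
    |L|+|R|≤fuel = ≤-trans (≤-reflexive (sym (suc-injective length-σ))) n≤fuel
    l = decode fuel (length R + lo) L (m+n≤o⇒m≤o (length L) |L|+|R|≤fuel) (proj₁ split)
    r = decode fuel lo R (m+n≤o⇒n≤o (length L) |L|+|R|≤fuel) (proj₂ split)

  -- The two enumerations agree up to order.

  ∈-forest⁻ : ∀ fuel n {τ} → τ ∈ forest fuel n → size τ ≡ n
  ∈-forest⁻ _          zero    (here refl) = refl
  ∈-forest⁻ (suc fuel) (suc n) {τ} τ∈ with ∈-concat⁻′ (tabulate (nodesWithLeft fuel n)) τ∈
  ... | _ , τ∈ , ts∈ with ∈-tabulate⁻ {f = nodesWithLeft fuel n} ts∈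
  ... | i , refl with ∈-cartesianProductWith⁻ node (forest fuel (toℕ i)) (forest fuel (n ∸ toℕ i)) τ∈
  ... | l , r , l∈ , r∈ , refl = cong suc (begin
    size l + size r         ≡⟨ cong₂ _+_ (∈-forest⁻ fuel (toℕ i) l∈) (∈-forest⁻ fuel (n ∸ toℕ i) r∈) ⟩
    toℕ i + (n ∸ toℕ i)     ≡⟨ m+[n∸m]≡n (toℕ≤pred[n] i) ⟩
    n                       ∎)
    where open ≡-Reasoning

  ∈-trees : ∀ τ → τ ∈ trees (size τ)
  ∈-trees leaf       = here refl
  ∈-trees (node l r) = subst (node l r ∈_) (sym (trees-suc n))
    (∈-concat⁺′ (∈-cartesianProductWith⁺ node l∈ r∈)
      (∈-tabulate⁺ {f = λ i → cartesianProductWith node (trees (toℕ i)) (trees (n ∸ toℕ i))} i))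
    where
    n = size l + size r
    i = fromℕ< {size l} (s≤s (m≤m+n (size l) (size r)))
    toℕ-i : toℕ i ≡ size l
    toℕ-i = toℕ-fromℕ< _
    l∈ : l ∈ trees (toℕ i)
    l∈ = subst (λ k → l ∈ trees k) (sym toℕ-i) (∈-trees l)
    r∈ : r ∈ trees (n ∸ toℕ i)
    r∈ = subst (λ k → r ∈ trees k) (sym (trans (cong (n ∸_) toℕ-i) (m+n∸m≡n (size l) (size r)))) (∈-trees r)

  -- The blocks are disjoint because the index of a block is the size of the left subtree.
  forest-unique : ∀ fuel n → Unique (forest fuel n)
  forest-unique _          zero    = [] ∷ []
  forest-unique zero       (suc n) = []
  forest-unique (suc fuel) (suc n) = Unique.concat⁺
    (All.tabulate⁺ {n = suc n} λ i → Unique.cartesianProductWith⁺ node (λ { refl → refl , refl })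
      (forest-unique fuel (toℕ i)) (forest-unique fuel (n ∸ toℕ i)))
    (AllPairs.tabulate⁺ {n = suc n} λ {i} {j} i≢j (τ∈ᵢ , τ∈ⱼ) → i≢j (toℕ-injective (same-left i j τ∈ᵢ τ∈ⱼ)))
    where
    same-left : ∀ i j {τ} → τ ∈ cartesianProductWith node (forest fuel (toℕ i)) (forest fuel (n ∸ toℕ i)) →
                τ ∈ cartesianProductWith node (forest fuel (toℕ j)) (forest fuel (n ∸ toℕ j)) → toℕ {suc n} i ≡ toℕ {suc n} j
    same-left i j τ∈ᵢ τ∈ⱼ
      with ∈-cartesianProductWith⁻ node (forest fuel (toℕ i)) (forest fuel (n ∸ toℕ i)) τ∈ᵢ
         | ∈-cartesianProductWith⁻ node (forest fuel (toℕ j)) (forest fuel (n ∸ toℕ j)) τ∈ⱼ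
    ... | _ , _ , l∈ᵢ , _ , refl | _ , _ , l∈ⱼ , _ , refl = trans (sym (∈-forest⁻ fuel _ l∈ᵢ)) (∈-forest⁻ fuel _ l∈ⱼ)

  ∈-words⁺ : ∀ {letters w} → All (_∈ letters) w → w ∈ words letters (length w)
  ∈-words⁺ []       = here refl
  ∈-words⁺ (a∈ ∷ w∈) = ∈-cartesianProductWith⁺ _∷_ a∈ (∈-words⁺ w∈)

  ∈-words⁻ : ∀ letters n {w} → w ∈ words letters n → length w ≡ n × All (_∈ letters) w
  ∈-words⁻ letters zero    (here refl) = refl , []
  ∈-words⁻ letters (suc n) w∈ with ∈-cartesianProductWith⁻ _∷_ letters (words letters n) w∈
  ... | _ , _ , a∈ , w′∈ , refl = let length≡ , w′⊆ = ∈-words⁻ letters n w′∈ in cong suc length≡ , a∈ ∷ w′⊆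

  words-unique : ∀ {letters} n → Unique letters → Unique (words letters n)
  words-unique zero    !letters = [] ∷ []
  words-unique (suc n) !letters = Unique.cartesianProductWith⁺ _∷_ (λ { refl → refl , refl }) !letters (words-unique n !letters)

  132-avoiders-unique : ∀ n → Unique (𝒮[ 1 ∷ 3 ∷ 2 ∷ [] ] n)
  132-avoiders-unique n = Unique.filter⁺ (avoids? _) (Unique.filter⁺ (unique? _≟_)
    (words-unique n (Unique.applyUpTo⁺₁ suc n λ i<j _ → <⇒≢ i<j ∘ suc-injective)))

  ∈-132-avoiders⁺ : ∀ {σ} → IsAvoider 0 σ → σ ∈ 𝒮[ 1 ∷ 3 ∷ 2 ∷ [] ] (length σ)
  ∈-132-avoiders⁺ {σ} (avoider !σ within av) = ∈-filter⁺ (avoids? _) (∈-filter⁺ (unique? _≟_)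
    (∈-words⁺ (All.map letter within)) !σ) (avoids132⇒avoids av)
    where
    letter : ∀ {a} → 0 < a × a ≤ length σ + 0 → a ∈ applyUpTo suc (length σ)
    letter {suc a} (_ , a<) = ∈-applyUpTo⁺ suc (≤-trans a< (≤-reflexive (+-identityʳ _)))

  ∈-132-avoiders⁻ : ∀ n {σ} → σ ∈ 𝒮[ 1 ∷ 3 ∷ 2 ∷ [] ] n → length σ ≡ n × IsAvoider 0 σ
  ∈-132-avoiders⁻ n {σ} σ∈ with ∈-filter⁻ (avoids? _) {xs = 𝒮 n} σ∈
  ... | σ∈ , av with ∈-filter⁻ (unique? _≟_) {xs = words (applyUpTo suc n) n} σ∈
  ... | σ∈ , !σ with ∈-words⁻ _ n σ∈
  ... | refl , letters = refl , avoider !σ (All.map bounds letters) (avoids⇒avoids132 av)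
    where
    bounds : ∀ {a} → a ∈ applyUpTo suc n → 0 < a × a ≤ n + 0
    bounds a∈ with ∈-applyUpTo⁻ suc a∈
    ... | _ , i<n , refl = s≤s z≤n , ≤-trans i<n (≤-reflexive (sym (+-identityʳ n)))

  -- Lists without repetition that have the same members are equal as bags, hence rearrangements of
  -- each other, and sums do not see the order.
  132-avoiders↭trees : ∀ n → 𝒮[ 1 ∷ 3 ∷ 2 ∷ [] ] n ↭ map (word 0) (trees n)
  132-avoiders↭trees n = ∼bag⇒↭ (unique∧set⇒bag (132-avoiders-unique n)
    (Unique.map⁺ (word-injective 0 _ _) (forest-unique n n)) (mk⇔ to from))
    where
    to : ∀ {σ} → σ ∈ 𝒮[ 1 ∷ 3 ∷ 2 ∷ [] ] n → σ ∈ map (word 0) (trees n)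
    to {σ} σ∈ with ∈-132-avoiders⁻ n σ∈
    ... | refl , σ-avoider with decode (length σ) 0 σ ≤-refl σ-avoider
    ... | τ , refl = ∈-map⁺ (word 0) (subst (λ k → τ ∈ trees k) (sym (length-word 0 τ)) (∈-trees τ))
    from : ∀ {σ} → σ ∈ map (word 0) (trees n) → σ ∈ 𝒮[ 1 ∷ 3 ∷ 2 ∷ [] ] n
    from σ∈ with ∈-map⁻ (word 0) σ∈
    ... | τ , τ∈ , refl = subst (λ k → word 0 τ ∈ 𝒮[ 1 ∷ 3 ∷ 2 ∷ [] ] k)
      (trans (length-word 0 τ) (∈-forest⁻ n n τ∈))
      (∈-132-avoiders⁺ (avoider (word-unique 0 τ)
        (weaken ≤-refl (≤-reflexive (cong (_+ 0) (sym (length-word 0 τ)))) (word-within 0 τ))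
        (word-avoids132 0 τ)))

  -- Descents of the word of a tree.

  des-∷ : ∀ a b w → des (a ∷ b ∷ w) ≡ indicator (b <ᵇ a) + des (b ∷ w)
  des-∷ a b w with b <ᵇ a
  ... | true  = refl
  ... | false = refl

  <ᵇ-true : ∀ {a b} → a < b → (a <ᵇ b) ≡ true
  <ᵇ-true {a} {b} = dec-true (a <? b)

  <ᵇ-false : ∀ {a b} → b < a → (a <ᵇ b) ≡ false
  <ᵇ-false {a} {b} b<a = dec-false (a <? b) (<-asym b<a)

  nonEmpty : Word → Bool
  nonEmpty []      = false
  nonEmpty (_ ∷ _) = true

  des-max-∷ : ∀ {m} R → All (_< m) R → des (m ∷ R) ≡ indicator (nonEmpty R) + des R
  des-max-∷     []      []        = refl
  des-max-∷ {m} (b ∷ R) (b<m ∷ _) = trans (des-∷ m b R) (cong (λ d → indicator d + des (b ∷ R)) (<ᵇ-true b<m))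

  -- The step from the end of `L` up to `m` is an ascent, so cutting there loses no descent.
  des-++-∷ : ∀ L {m R} → All (_< m) L → des (L ++ m ∷ R) ≡ des L + des (m ∷ R)
  des-++-∷ []              _           = refl
  des-++-∷ (a ∷ [])    {m} {R} (a<m ∷ _) = trans (des-∷ a m R) (cong (λ d → indicator d + des (m ∷ R)) (<ᵇ-false a<m))
  des-++-∷ (a ∷ b ∷ L) {m} {R} (_ ∷ L<m) = begin
    des (a ∷ b ∷ L ++ m ∷ R)                                ≡⟨ des-∷ a b (L ++ m ∷ R) ⟩
    indicator (b <ᵇ a) + des (b ∷ L ++ m ∷ R)               ≡⟨ cong (indicator (b <ᵇ a) +_) (des-++-∷ (b ∷ L) L<m) ⟩
    indicator (b <ᵇ a) + (des (b ∷ L) + des (m ∷ R))        ≡⟨ +-assoc (indicator (b <ᵇ a)) _ _ ⟨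
    indicator (b <ᵇ a) + des (b ∷ L) + des (m ∷ R)          ≡⟨ cong (_+ des (m ∷ R)) (des-∷ a b L) ⟨
    des (a ∷ b ∷ L) + des (m ∷ R)                           ∎
    where open ≡-Reasoning

  nonEmpty-++-∷ : ∀ L {m R} → nonEmpty (L ++ m ∷ R) ≡ true
  nonEmpty-++-∷ []      = refl
  nonEmpty-++-∷ (_ ∷ _) = refl

  nonEmpty-word : ∀ lo τ → nonEmpty (word lo τ) ≡ isNode τ
  nonEmpty-word lo leaf       = refl
  nonEmpty-word lo (node l r) = nonEmpty-++-∷ (word (size r + lo) l)

  des-word : ∀ lo τ → des (word lo τ) ≡ descents τ
  des-word lo leaf       = refl
  des-word lo (node l r) = begin
    des (L ++ m ∷ R)                              ≡⟨ des-++-∷ L (wordˡ-below lo l r) ⟩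
    des L + des (m ∷ R)                           ≡⟨ cong (des L +_) (des-max-∷ R (wordʳ-below lo l r)) ⟩
    des L + (indicator (nonEmpty R) + des R)      ≡⟨ cong₂ _+_ (des-word _ l) (cong₂ _+_ (cong indicator (nonEmpty-word lo r)) (des-word lo r)) ⟩
    descents (node l r)                           ∎
    where
    open ≡-Reasoning
    L = word (size r + lo) l
    R = word lo r
    m = suc (size l + (size r + lo))

  lastDescent : Word → Bool
  lastDescent []              = false
  lastDescent (_ ∷ [])        = false
  lastDescent (a ∷ b ∷ [])    = b <ᵇ a
  lastDescent (_ ∷ b ∷ c ∷ w) = lastDescent (b ∷ c ∷ w)

  lastDescent-++-∷ : ∀ L {m R} → All (_< m) L → lastDescent (L ++ m ∷ R) ≡ lastDescent (m ∷ R)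
  lastDescent-++-∷ []                  _         = refl
  lastDescent-++-∷ (a ∷ []) {R = []}   (a<m ∷ _) = <ᵇ-false a<m
  lastDescent-++-∷ (_ ∷ []) {R = _ ∷ _} _        = refl
  lastDescent-++-∷ (_ ∷ b ∷ []) {R = R} (_ ∷ L<m) = lastDescent-++-∷ (b ∷ []) {R = R} L<m
  lastDescent-++-∷ (_ ∷ b ∷ c ∷ L)      (_ ∷ L<m) = lastDescent-++-∷ (b ∷ c ∷ L) L<m

  -- A larger letter in front turns ending with the smallest letter into ending with a descent: it
  -- supplies the descent of a one-letter word and leaves the last two letters of a longer word
  -- alone.
  lastDescent-∷-word : ∀ {m} lo τ → All (_< m) (word lo τ) → lastDescent (m ∷ word lo τ) ≡ endsWithMin τ
  lastDescent-∷-word lo leaf _ = refl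
  lastDescent-∷-word lo (node leaf leaf) (r<m ∷ _) = <ᵇ-true r<m
  lastDescent-∷-word {m} lo (node l@(node l₁ l₂) leaf) _ = begin
    lastDescent (m ∷ L ++ n ∷ [])        ≡⟨ drop-head L (nonEmpty-word lo l) ⟩
    lastDescent (L ++ n ∷ [])            ≡⟨ lastDescent-++-∷ L (wordˡ-below lo l leaf) ⟩
    false                                ∎
    where
    open ≡-Reasoning
    L = word lo l
    n = suc (size l + lo)
    drop-head : ∀ L → nonEmpty L ≡ true → lastDescent (m ∷ L ++ n ∷ []) ≡ lastDescent (L ++ n ∷ [])
    drop-head (_ ∷ [])    _ = refl
    drop-head (_ ∷ _ ∷ _) _ = refl
  lastDescent-∷-word {m} lo (node l r@(node _ _)) _ = begin
    lastDescent (m ∷ L ++ n ∷ R)         ≡⟨ drop-head L R (nonEmpty-word lo r) ⟩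
    lastDescent (L ++ n ∷ R)             ≡⟨ lastDescent-++-∷ L (wordˡ-below lo l r) ⟩
    lastDescent (n ∷ R)                  ≡⟨ lastDescent-∷-word lo r (wordʳ-below lo l r) ⟩
    endsWithMin r                        ∎
    where
    open ≡-Reasoning
    L = word (size r + lo) l
    R = word lo r
    n = suc (size l + (size r + lo))
    drop-head : ∀ L R → nonEmpty R ≡ true → lastDescent (m ∷ L ++ n ∷ R) ≡ lastDescent (L ++ n ∷ R)
    drop-head []          (_ ∷ _) _ = refl
    drop-head (_ ∷ [])    (_ ∷ _) _ = refl
    drop-head (_ ∷ _ ∷ _) (_ ∷ _) _ = refl

  lastDescent-word : ∀ lo τ → lastDescent (word lo τ) ≡ endsWithDescent τ
  lastDescent-word lo leaf       = refl
  lastDescent-word lo (node l r) = trans (lastDescent-++-∷ (word (size r + lo) l) (wordˡ-below lo l r))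
                                         (lastDescent-∷-word lo r (wordʳ-below lo l r))

  -- Matches of 213 in the word of a tree.

  length-filter-applyUpTo :
    ∀ {a p q} {A : Set a} {P : Pred A p} {Q : Pred A q} (P? : Decidable P) (Q? : Decidable Q) {f g : ℕ → A} →
    (∀ i → does (P? (f i)) ≡ does (Q? (g i))) →
    ∀ n → length (filter P? (applyUpTo f n)) ≡ length (filter Q? (applyUpTo g n))
  length-filter-applyUpTo P? Q?         same zero    = refl
  length-filter-applyUpTo P? Q? {f} {g} same (suc n)
    with does (P? (f 0)) | does (Q? (g 0)) | same 0 | length-filter-applyUpTo P? Q? {f ∘ suc} {g ∘ suc} (same ∘ suc) n
  ... | true  | true  | refl | ih = cong suc ih
  ... | false | false | refl | ih = ih

  module _ (pat : Word) where
    private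
      Match : Word → ℕ → Set
      Match w i = red (take (length pat) (drop i w)) ≡ pat

      match? : ∀ w → Decidable (Match w)
      match? w i = ≡-dec _≟_ (red (take (length pat) (drop i w))) pat

      -- The window of `a ∷ w` at `suc i` computes to the window of `w` at `i`, so only the window
      -- at `0` needs a decision.
      mch-tail : ∀ a w → length (filter (match? (a ∷ w)) (applyUpTo suc (length w))) ≡ mch pat w
      mch-tail a w = length-filter-applyUpTo (match? (a ∷ w)) (match? w) (λ _ → refl) (length w)

    mch-accept : ∀ a w → red (take (length pat) (a ∷ w)) ≡ pat → mch pat (a ∷ w) ≡ suc (mch pat w)
    mch-accept a w match = trans (cong length (filter-accept (match? (a ∷ w)) match)) (cong suc (mch-tail a w))

    mch-reject : ∀ a w → red (take (length pat) (a ∷ w)) ≢ pat → mch pat (a ∷ w) ≡ mch pat w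
    mch-reject a w ¬match = trans (cong length (filter-reject (match? (a ∷ w)) ¬match)) (mch-tail a w)

  213-mch : Word → ℕ
  213-mch = mch (2 ∷ 1 ∷ 3 ∷ [])

  private
    213-accept = mch-accept (2 ∷ 1 ∷ 3 ∷ [])
    213-reject = mch-reject (2 ∷ 1 ∷ 3 ∷ [])

  red-213 : ∀ {a b c} → b < a → a < c → red (a ∷ b ∷ c ∷ []) ≡ 2 ∷ 1 ∷ 3 ∷ []
  red-213 {a} {b} {c} b<a a<c = cong₂ _∷_
    (trans (rank-accept (b ∷ c ∷ []) (≤-refl {a})) (cong suc (trans (rank-accept (c ∷ []) (<⇒≤ b<a)) (cong suc (rank-reject [] a<c)))))
    (cong₂ _∷_
    (trans (rank-reject (b ∷ c ∷ []) b<a) (trans (rank-accept (c ∷ []) (≤-refl {b})) (cong suc (rank-reject [] b<c))))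
    (cong (_∷ [])
    (trans (rank-accept (b ∷ c ∷ []) (<⇒≤ a<c)) (cong suc (trans (rank-accept (c ∷ []) (<⇒≤ b<c)) (cong suc (rank-accept [] (≤-refl {c}))))))))
    where
    b<c = <-trans b<a a<c

  red-213⁻ : ∀ {a b c} → red (a ∷ b ∷ c ∷ []) ≡ 2 ∷ 1 ∷ 3 ∷ [] → b < a × a < c
  red-213⁻ {a} {b} {c} eq = b<a , a<c
    where
    rankᵃ : rank a (a ∷ b ∷ c ∷ []) ≡ 2
    rankᵃ = cong (λ { (i ∷ _) → i ; _ → 0 }) eq
    rankᵇ : rank b (a ∷ b ∷ c ∷ []) ≡ 1
    rankᵇ = cong (λ { (_ ∷ i ∷ _) → i ; _ → 0 }) eq
    b<a : b < a
    b<a = ≰⇒> λ a≤b → contradiction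
      (trans (sym rankᵇ) (trans (rank-accept (b ∷ c ∷ []) a≤b) (cong suc (rank-accept (c ∷ []) (≤-refl {b}))))) λ ()
    a<c : a < c
    a<c = ≰⇒> λ c≤a → contradiction
      (trans (sym rankᵃ) (trans (rank-accept (b ∷ c ∷ []) (≤-refl {a}))
        (cong suc (trans (rank-accept (c ∷ []) (<⇒≤ b<a)) (cong suc (rank-accept [] c≤a)))))) λ ()

  213-mch-∷∷max-∷ : ∀ {a b m} R → a < m → 213-mch (a ∷ b ∷ m ∷ R) ≡ indicator (b <ᵇ a) + 213-mch (b ∷ m ∷ R)
  213-mch-∷∷max-∷ {a} {b} {m} R a<m with b <? a
  ... | yes b<a = trans (213-accept a (b ∷ m ∷ R) (red-213 b<a a<m)) (cong (λ d → indicator d + 213-mch (b ∷ m ∷ R)) (sym (<ᵇ-true b<a)))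
  ... | no  b≮a = trans (213-reject a (b ∷ m ∷ R) (b≮a ∘ proj₁ ∘ red-213⁻ {a} {b} {m}))
                        (cong (λ d → indicator d + 213-mch (b ∷ m ∷ R)) (sym (dec-false (b <? a) b≮a)))

  213-mch-max-∷ : ∀ {m} R → All (_< m) R → 213-mch (m ∷ R) ≡ 213-mch R
  213-mch-max-∷ {m} []          _             = 213-reject m [] λ ()
  213-mch-max-∷ {m} (b ∷ [])    _             = 213-reject m (b ∷ []) λ ()
  213-mch-max-∷ {m} (b ∷ c ∷ R) (_ ∷ c<m ∷ _) = 213-reject m (b ∷ c ∷ R) (<-asym c<m ∘ proj₂ ∘ red-213⁻ {m} {b} {c})

  213-mch-∷-max-∷ : ∀ {a m} R → a < m → All (_< m) R → 213-mch (a ∷ m ∷ R) ≡ 213-mch R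
  213-mch-∷-max-∷ {a} {m} []      a<m _   = trans (213-reject a (m ∷ []) λ ()) (213-reject m [] λ ())
  213-mch-∷-max-∷ {a} {m} (c ∷ R) a<m R<m = trans (213-reject a (m ∷ c ∷ R) (<-asym a<m ∘ proj₁ ∘ red-213⁻ {a} {m} {c})) (213-mch-max-∷ (c ∷ R) R<m)

  -- Among the windows through `m`, only the one with `m` last can match, since the 3 of 213 stands
  -- there; it matches exactly when `L` ends with a descent.
  213-mch-++-∷ : ∀ L {m R} → All (_< m) L → All (_< m) R →
                 213-mch (L ++ m ∷ R) ≡ 213-mch L + (indicator (lastDescent L) + 213-mch R)
  213-mch-++-∷ []               {m} {R} _                 R<m = 213-mch-max-∷ R R<m
  213-mch-++-∷ (a ∷ [])     {m} {R} (a<m ∷ _)         R<m =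
    trans (213-mch-∷-max-∷ R a<m R<m) (cong (_+ 213-mch R) (sym (213-reject a [] λ ())))
  213-mch-++-∷ (a ∷ b ∷ []) {m} {R} (a<m ∷ b<m ∷ _)   R<m = begin
    213-mch (a ∷ b ∷ m ∷ R)                          ≡⟨ 213-mch-∷∷max-∷ {a} {b} {m} R a<m ⟩
    indicator (b <ᵇ a) + 213-mch (b ∷ m ∷ R)         ≡⟨ cong (indicator (b <ᵇ a) +_) (213-mch-∷-max-∷ {b} {m} R b<m R<m) ⟩
    indicator (b <ᵇ a) + 213-mch R                   ≡⟨ cong (_+ (indicator (b <ᵇ a) + 213-mch R))
                                                          (trans (213-reject a (b ∷ []) λ ()) (213-reject b [] λ ())) ⟨
    213-mch (a ∷ b ∷ []) + (indicator (b <ᵇ a) + 213-mch R) ∎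
    where open ≡-Reasoning
  -- The first window lies inside `L`, so it matches on both sides or on neither.
  213-mch-++-∷ (a ∷ b ∷ c ∷ L) {m} {R} (_ ∷ L<m) R<m
    with ih ← 213-mch-++-∷ (b ∷ c ∷ L) L<m R<m
       | ≡-dec _≟_ (red (a ∷ b ∷ c ∷ [])) (2 ∷ 1 ∷ 3 ∷ [])
  ... | yes match  = trans (213-accept a _ match) (trans (cong suc ih)
      (cong (_+ (indicator (lastDescent (b ∷ c ∷ L)) + 213-mch R)) (sym (213-accept a (b ∷ c ∷ L) match))))
  ... | no  ¬match = trans (213-reject a _ ¬match) (trans ih
      (cong (_+ (indicator (lastDescent (b ∷ c ∷ L)) + 213-mch R)) (sym (213-reject a (b ∷ c ∷ L) ¬match))))

  213-mch-word : ∀ lo τ → 213-mch (word lo τ) ≡ matches τ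
  213-mch-word lo leaf       = refl
  213-mch-word lo (node l r) = begin
    213-mch (L ++ m ∷ R)                                       ≡⟨ 213-mch-++-∷ L (wordˡ-below lo l r) (wordʳ-below lo l r) ⟩
    213-mch L + (indicator (lastDescent L) + 213-mch R)        ≡⟨ cong₂ _+_ (213-mch-word _ l) (cong₂ _+_ (cong indicator (lastDescent-word _ l)) (213-mch-word lo r)) ⟩
    matches (node l r)                                         ∎
    where
    open ≡-Reasoning
    L = word (size r + lo) l
    R = word lo r
    m = suc (size l + (size r + lo))

-- The avoider series equals the tree series.

module AvoiderSeries (R : CommutativeRing c ℓ) (x y : CommutativeRing.Carrier R) where
  open CommutativeRing R
  open FiniteSum R
  open Avoiders using (word; 213-mch; des-word; 213-mch-word; 132-avoiders↭trees)
  open TreeSeries R x y using (series; weight)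
  open RawSemiringDefs (RawRing.rawSemiring rawRing) using (_^_)

  wordWeight : Word → Carrier
  wordWeight σ = y ^ des σ * x ^ 213-mch σ

  wordWeight-word : ∀ τ → wordWeight (word 0 τ) ≈ weight τ
  wordWeight-word τ = reflexive (≡.cong₂ (λ d m → y ^ d * x ^ m) (des-word 0 τ) (213-mch-word 0 τ))

  -- Over `ℚ[x,y]` the left side is by computation the coefficient `A n` of the statement.
  avoiders≈trees : ∀ n → ∑ wordWeight (𝒮[ 1 ∷ 3 ∷ 2 ∷ [] ] n) ≈ series weight n
  avoiders≈trees n = trans (∑-↭ wordWeight (132-avoiders↭trees n))
    (trans (∑-map wordWeight (word 0) (trees n)) (∑-cong wordWeight-word (trees n)))

-- Specialisation to `ℚ[x,y]`.

open import Defs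
open import Data.Product using (∃-syntax; _×_)

private
  ℚ[x,y]-commutativeRing : CommutativeRing _ _
  ℚ[x,y]-commutativeRing = PolynomialRing.commutativeRing (PolynomialRing.commutativeRing ℚ.+-*-commutativeRing)

  open TreeSeries ℚ[x,y]-commutativeRing (ℚ[x][y].const ℚ[x].X) ℚ[x][y].X using (root; root-discriminant; root-quotient)
  open AvoiderSeries ℚ[x,y]-commutativeRing (ℚ[x][y].const ℚ[x].X) ℚ[x][y].X using (avoiders≈trees)

  IsQuotient : (F num den : Carrier) → Set _
  IsQuotient F num den = (1≉0 : 1# ≉ 0#) (den≉0 : den ≉ 0#) → F / 1# [ 1≉0 ] ≃ num / den [ den≉0 ]

  abstract
    -- Kept abstract so that checking the final statement does not unfold `root`.
    √Δ : Carrier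
    √Δ = root

    √Δ-discriminant : Discriminant _IsSqrtOf_ _+_ _*_ _-_ -_ _^_ 1# 2# t y x √Δ
    √Δ-discriminant = root-discriminant

    √Δ-quotient : Quotient IsQuotient _+_ _*_ _-_ -_ _^_ 1# 2# t y x √Δ A
    √Δ-quotient = root-quotient {A} avoiders≈trees

theorem5 : ∃[ √Δ ]
    √Δ IsSqrtOf
    (t * (2# * y * (x * (t - 1#) * t - t ^ 2 - 1#)
    + t * y ^ 2 * (- (x * t) + t + 1#) ^ 2
    + t - 2#)
    + 1#)
    ×
    ↑ A ≃ (- √Δ + (x - 1#) * t ^ 2 * y * (2# * y - 1#) + t * (y - 1#) + 1#)
    / (2# * t * y * ((x - 1#) * t * y + 1#)) [ denominator≉0 ]
theorem5 = √Δ , √Δ-discriminant , √Δ-quotient 1≉0 denominator≉0
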